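{- Let $X$ be a multi-set of size $n$ and set $C_\delta := 1699200 \cdot \log(2n)\log^2(2\mu_X)$, $C_\alpha := 42480\cdot\log(2\mu_X)$, $C_\lambda := 169920\cdot\log(2\mu_X)$. If $X$ is $C_\delta$-dense and has no $C_\alpha$-almost divisor, then for $\lambda_X := C_\lambda \cdot \mu_X \max(X)\, \Sigma(X)/|X|^2$ we have \[ \{\lambda_X, \lambda_X+1, \dots, \Sigma(X)-\lambda_X\} \subseteq \mathcal{S}(X). \]
   Context: For a finite non-empty multi-set $X$ of positive integers: $|X|$ is the number of elements counted with multiplicity, $\max(X)$ its maximum element, $\mu_X$ the largest multiplicity of any number in $X$, $\Sigma(X)$ the sum of all elements (with multiplicity), and $\mathcal{S}(X) := \{\Sigma(Y)\mid Y\subseteq X\}$ the set of all subset sums. $X$ is $\delta$-dense if $|X|^2 \ge \delta\cdot\mu_X\cdot\max(X)$. For an integer $d$, $X(d) := X\cap d\mathbb{Z}$ is the multi-set of elements of $X$ divisible by $d$, and $\overline{X(d)} := X\setminus X(d)$. An integer $d>1$ is an $\alpha$-almost divisor of $X$ if $|\overline{X(d)}| \le \alpha\cdot\mu_X\cdot\Sigma(X)/|X|^2$. -}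

module Defs where

open import Data.Nat using (ℕ; zero; suc; _+_; _*_; _∸_; _^_; _≤_; _<_; _⊔_)
open import Data.Nat.Properties using (_≟_)
open import Data.Nat.Divisibility using (_∣_; _∣?_)
open import Data.List using (List; []; _∷_; length; map; foldr; filter)
open import Data.Nat.ListAction using (sum)
open import Data.List.Relation.Binary.Sublist.Propositional using (_⊆_)
open import Data.Product using (Σ; _×_; ∃-syntax)
open import Relation.Nullary.Negation using (¬_)
open import Relation.Nullary.Decidable using (¬?)
open import Relation.Binary.PropositionalEquality using (_≡_)

-- A finite multi-set of positive integers is represented by a list of
-- naturals (order irrelevant); positivity / non-emptiness are hypotheses.

size : List ℕ → ℕ
size = length

-- max(X)  (0 for the empty list, irrelevant since X is non-empty)
maxElem : List ℕ → ℕ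
maxElem = foldr _⊔_ 0

mult : ℕ → List ℕ → ℕ
mult x X = length (filter (_≟ x) X)

μ : List ℕ → ℕ
μ X = foldr _⊔_ 0 (map (λ x → mult x X) X)

Σ' : List ℕ → ℕ
Σ' = sum

-- s ∈ 𝒮(X): s is the sum of a sub-multiset Y of X
-- (sub-multisets of X = sublists of the list X)
InSubsetSums : ℕ → List ℕ → Set
InSubsetSums s X = ∃[ Y ] (Y ⊆ X × sum Y ≡ s)

notDivBy : ℕ → List ℕ → List ℕ
notDivBy d X = filter (λ x → ¬? (d ∣? x)) X

-- Logarithms are base 2.  The rational p/q (q > 0) is a
-- lower bound for log₂ b  iff  2^p ≤ b^q.  Since log₂ b is the supremum of
-- its nonnegative rational lower bounds (b ≥ 1), a real inequality
-- c · log₂ b · … ≤ R is expressed exactly by quantifying over all such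
-- lower bounds.  (For q = 0 the condition forces p = 0, which is harmless.)
Log2Above : ℕ → ℕ → ℕ → Set
Log2Above b p q = 2 ^ p ≤ b ^ q

-- p/q ≥ log₂ b  iff  b^q ≤ 2^p   (q > 0; q = 0 gives trivial instances)
Log2Below : ℕ → ℕ → ℕ → Set
Log2Below b p q = b ^ q ≤ 2 ^ p

-- X is C_δ-dense, C_δ = 1699200 · log(2n) · log²(2μ_X):
--   1699200 · log₂(2n) · log₂(2μ)² · μ · max(X) ≤ |X|²
Dense : List ℕ → Set
Dense X = ∀ p₁ q₁ p₂ q₂ →
  Log2Above (2 * size X) p₁ q₁ → Log2Above (2 * μ X) p₂ q₂ →
  1699200 * p₁ * (p₂ * p₂) * μ X * maxElem X
    ≤ (size X * size X) * q₁ * (q₂ * q₂)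

-- d > 1 is a C_α-almost divisor, C_α = 42480 · log(2μ_X):
--   |X̄(d)| ≤ 42480 · log₂(2μ) · μ · Σ(X) / |X|²
AlmostDivisor : List ℕ → ℕ → Set
--   i.e.  |X̄(d)| · |X|² ≤ 42480 · log₂(2μ) · μ · Σ(X),
-- expressed through all rational upper bounds p/q ≥ log₂(2μ)
-- (log₂ b is the infimum of its rational upper bounds).
AlmostDivisor X d = 1 < d × (∀ p q → Log2Below (2 * μ X) p q →
  length (notDivBy d X) * (size X * size X) * q
    ≤ 42480 * p * μ X * Σ' X)

-- λ_X ≤ t  where λ_X = 169920 · log₂(2μ) · μ · max(X) · Σ(X) / |X|²
LambdaLe : List ℕ → ℕ → Set
LambdaLe X t = ∀ p q → Log2Above (2 * μ X) p q →
  169920 * p * μ X * maxElem X * Σ' X ≤ t * (size X * size X) * q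

{-# OPTIONS --safe #-}
module Submission where

-- Let n = |X|, m = max X, σ = Σ(X).  Half of the elements are at most 2σ/n; take the lighter half A of
-- those, and by dyadic pigeonhole a set V of values each having at least q copies in A, with q |V| ≳ n / log(2μ).
--
-- A second dyadic pigeonhole, over the number of pairs in V ∪ {0} with a given sum, yields a set B of sums that
-- all have at least t representations by disjoint pairs.  Sums of up to tq/2 elements of B, with repetition, are
-- therefore subset sums of A.  Let N = max B and let d be the gcd of B.  Olson's theorem,
-- |S + B| ≥ |S| + |B|/2 unless S + B is periodic, shows that k₀ ≤ 3N/|B| summands reach every multiple of d
-- modulo N, and further copies of N reach every large multiple of d itself.  Moreover d ≤ N/|B|.
--
-- As X has no almost divisor, fewer than d elements R of X have subset sums covering ℤ/d.  Together these give
-- m consecutive subset sums starting at u = k₀N + dm, and adding the elements outside A and R greedily extends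
-- them to [u, σ/2].  Taking complements covers the upper half.

open import Defs
open import Data.Nat using (ℕ; _≤_; _<_; _∸_)
open import Data.List using (List; [])
open import Data.List.Relation.Unary.All using (All)
open import Relation.Nullary.Negation using (¬_)
open import Relation.Binary.PropositionalEquality using (_≢_)

open import Data.Nat
open import Data.Nat.Properties
open import Data.Nat.DivMod
open import Data.Nat.Divisibility
open import Data.Nat.GCD using (gcd; gcd[m,n]∣m; gcd[m,n]∣n; gcd-GCD; module Bézout)
open import Data.Nat.ListAction using (sum)
open import Data.Nat.ListAction.Properties using (sum-++; sum-↭)
open import Data.Nat.Tactic.RingSolver using (solve-∀)
open import Data.List using (_∷_; _++_; length; map; filter; foldr; upTo; replicate)
open import Data.List.Properties
  using (length-++; length-map; length-upTo; length-replicate; length-filter; ++-assoc;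
         filter-++; filter-accept; filter-reject; filter-none)
open import Data.List.Membership.DecPropositional _≟_ using (_∈_; _∉_; _∈?_; find; lose)
open import Data.List.Membership.Propositional.Properties
open import Data.List.Relation.Binary.Permutation.Propositional
  using (_↭_; ↭-refl; ↭-sym; ↭-trans; prep; ↭-reflexive)
open import Data.List.Relation.Binary.Permutation.Propositional.Properties
  using (filter-↭; ↭-length; shift; ++⁺ˡ; ++⁺ʳ; ++-comm; ∈-resp-↭)
open import Data.List.Relation.Binary.Sublist.Propositional using (_⊆_; []; _∷_; _∷ʳ_)
open import Data.List.Relation.Unary.Any using (Any; here; there; any?)
open import Data.List.Relation.Unary.All as All using ([]; _∷_; all?)
open import Data.List.Relation.Unary.All.Properties using (¬All⇒Any¬)
open import Data.List.Relation.Unary.AllPairs using ([]; _∷_)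
open import Data.List.Relation.Unary.Unique.Propositional using (Unique)
import Data.List.Relation.Unary.Unique.Propositional.Properties as Unique
open import Data.Product using (∃₂; ∃-syntax; _×_; _,_; proj₁; proj₂)
open import Data.Sum using (_⊎_; inj₁; inj₂)
open import Data.Empty using (⊥-elim)
open import Data.Unit using (tt)
open import Function using (_∘_; id)
open import Relation.Nullary using (Dec; yes; no)
open import Relation.Nullary.Decidable using (¬?; _×-dec_)
open import Relation.Binary.PropositionalEquality
open import Relation.Unary using (Pred; Decidable)

-- Duplicate-free lists and their lengths.

unique-⊆-length : ∀ {xs ys : List ℕ} → Unique xs → (∀ {x} → x ∈ xs → x ∈ ys) → length xs ≤ length ys
unique-⊆-length {[]} _ _ = z≤n
unique-⊆-length {x ∷ xs} {ys} (x∉ ∷ u) sub with ∈-∃++ (sub (here refl))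
... | ys₁ , ys₂ , refl = begin
  suc (length xs)             ≤⟨ s≤s (unique-⊆-length u sub′) ⟩
  suc (length (ys₁ ++ ys₂))   ≡⟨ cong suc (length-++ ys₁) ⟩
  suc (length ys₁ + length ys₂) ≡⟨ +-suc (length ys₁) (length ys₂) ⟨
  length ys₁ + suc (length ys₂) ≡⟨ length-++ ys₁ ⟨
  length (ys₁ ++ x ∷ ys₂) ∎
  where
  open ≤-Reasoning
  sub′ : ∀ {z} → z ∈ xs → z ∈ ys₁ ++ ys₂
  sub′ z∈ with ∈-++⁻ ys₁ (sub (there z∈))
  ... | inj₁ p = ∈-++⁺ˡ p
  ... | inj₂ (here refl) = ⊥-elim (All.lookup x∉ z∈ refl)
  ... | inj₂ (there p) = ∈-++⁺ʳ ys₁ p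

unique-<-length : ∀ {xs n} → Unique xs → All (_< n) xs → length xs ≤ n
unique-<-length {xs} {n} u b = subst (length xs ≤_) (length-upTo n)
  (unique-⊆-length u (λ x∈ → ∈-upTo⁺ (All.lookup b x∈)))

unique-map-on : ∀ (f : ℕ → ℕ) {xs} → (∀ {x y} → x ∈ xs → y ∈ xs → f x ≡ f y → x ≡ y) → Unique xs → Unique (map f xs)
unique-map-on f {[]} inj [] = []
unique-map-on f {x ∷ xs} inj (x∉ ∷ u) =
  All.tabulate (λ z∈ eq → let y , y∈ , e = ∈-map⁻ f z∈ in
    All.lookup x∉ y∈ (inj (here refl) (there y∈) (trans eq e)))
  ∷ unique-map-on f (λ p q → inj (there p) (there q)) u

length-filter-split : ∀ {p} {P : Pred ℕ p} (P? : Decidable P) xs →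
  length (filter P? xs) + length (filter (¬? ∘ P?) xs) ≡ length xs
length-filter-split P? [] = refl
length-filter-split P? (x ∷ xs) with P? x
... | yes _ = cong suc (length-filter-split P? xs)
... | no _ = trans (+-suc _ _) (cong suc (length-filter-split P? xs))

-- Shift-invariant predicates, gcds and congruences.

Closed : (ℕ → Set) → ℕ → Set
Closed P t = ∀ x → P x → P (x + t)

closed-* : ∀ P k t → Closed P t → Closed P (k * t)
closed-* P zero t c x p = subst P (sym (+-identityʳ x)) p
closed-* P (suc k) t c x p = subst P (+-assoc x t (k * t)) (closed-* P k t c (x + t) (c x p))

-- For a predicate on ℤ/N a shift by −y is a shift by (N − 1) y.
module _ {P : ℕ → Set} (n : ℕ) (up : Closed P (suc n)) (down : ∀ x → P (x + suc n) → P x) where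

  private
    down-* : ∀ k {x} → P (x + k * suc n) → P x
    down-* zero {x} p = subst P (+-identityʳ x) p
    down-* (suc k) {x} p = down _ (down-* k (subst P (sym (+-assoc x (suc n) (k * suc n))) p))

    combine : ∀ {a b d} → Closed P a → Closed P b → ∀ u v → d + v * b ≡ u * a → Closed P d
    combine {a} {b} {d} ca cb u v eq x p =
      down-* (v * b) (subst P lemma (closed-* P (n * v) b cb _ (closed-* P u a ca x p)))
      where
      ring : ∀ x d vb n → x + (d + vb) + n * vb ≡ x + d + vb * suc n
      ring = solve-∀
      lemma : x + u * a + n * v * b ≡ x + d + v * b * suc n
      lemma = trans (cong₂ (λ s t → x + s + t) (sym eq) (*-assoc n v b)) (ring x d (v * b) n)

  closed-gcd : ∀ {a b} → Closed P a → Closed P b → Closed P (gcd a b)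
  closed-gcd {a} {b} ca cb with Bézout.identity (gcd-GCD a b)
  ... | Bézout.+- u v eq = combine ca cb u v eq
  ... | Bézout.-+ v u eq = combine cb ca u v eq

  closed-gcds : ∀ {xs} → All (Closed P) xs → Closed P (foldr gcd (suc n) xs)
  closed-gcds [] = up
  closed-gcds {x ∷ xs} (c ∷ cs) = closed-gcd {x} {foldr gcd (suc n) xs} c (closed-gcds cs)

gcds∣init : ∀ n xs → foldr gcd n xs ∣ n
gcds∣init n [] = ∣-refl
gcds∣init n (x ∷ xs) = ∣-trans (gcd[m,n]∣n x _) (gcds∣init n xs)

gcds∣all : ∀ n xs → All (foldr gcd n xs ∣_) xs
gcds∣all n [] = []
gcds∣all n (x ∷ xs) = gcd[m,n]∣m x _ ∷ All.map (∣-trans (gcd[m,n]∣n x _)) (gcds∣all n xs)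

∣-nonZero : ∀ {d n} → d ∣ suc n → NonZero d
∣-nonZero {zero} 0∣ with () ← 0∣⇒≡0 0∣
∣-nonZero {suc d} _ = _

-- When `a < b` the truncated difference is 0, so both orders are covered.
%≡⇒∣∸ : ∀ {a b} e .{{_ : NonZero e}} → a % e ≡ b % e → e ∣ a ∸ b
%≡⇒∣∸ {a} {b} e eq = divides (a / e ∸ b / e) (begin
  a ∸ b ≡⟨ cong₂ _∸_ (m≡m%n+[m/n]*n a e) (m≡m%n+[m/n]*n b e) ⟩
  (a % e + a / e * e) ∸ (b % e + b / e * e) ≡⟨ cong (λ r → (r + a / e * e) ∸ (b % e + b / e * e)) eq ⟩
  (b % e + a / e * e) ∸ (b % e + b / e * e) ≡⟨ [m+n]∸[m+o]≡n∸o (b % e) _ _ ⟩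
  a / e * e ∸ b / e * e ≡⟨ *-distribʳ-∸ e (a / e) (b / e) ⟨
  (a / e ∸ b / e) * e ∎)
  where open ≡-Reasoning

%-%-∣ : ∀ x {e N} .{{_ : NonZero e}} .{{_ : NonZero N}} → e ∣ N → x % N % e ≡ x % e
%-%-∣ x {e} {N} e∣N = begin
  x % N % e ≡⟨ %-remove-+ʳ (x % N) (∣n⇒∣m*n (x / N) e∣N) ⟨
  (x % N + x / N * N) % e ≡⟨ cong (_% e) (m≡m%n+[m/n]*n x N) ⟨
  x % e ∎
  where open ≡-Reasoning

-- Since `z` may exceed `w`, steps of `e` first lead up from `z` to `w + z * suc n`, which is at
-- least `z`; then `z` steps of `suc n` lead down to `w`.
closed-≡ : ∀ {P : ℕ → Set} n → (∀ x → P (x + suc n) → P x) → ∀ e .{{_ : NonZero e}} → e ∣ suc n → Closed P e →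
  ∀ {z w} → P z → w % e ≡ z % e → P w
closed-≡ {P} n down e e∣N ce {z} {w} pz eq = go z (subst P lemma (closed-* P (quotient e∣) e ce z pz))
  where
  open ≡-Reasoning
  e∣ : e ∣ (w + z * suc n) ∸ z
  e∣ = %≡⇒∣∸ e (trans (%-remove-+ʳ w (∣n⇒∣m*n z e∣N)) eq)
  le : z ≤ w + z * suc n
  le = ≤-trans (m≤m*n z (suc n)) (m≤n+m _ w)
  lemma : z + quotient e∣ * e ≡ w + z * suc n
  lemma = trans (cong (z +_) (sym (m∣n⇒n≡quotient*m e∣))) (m+[n∸m]≡n le)
  go : ∀ k → P (w + k * suc n) → P w
  go zero p = subst P (+-identityʳ w) p
  go (suc k) p = go k (down _ (subst P (trans (cong (w +_) (+-comm (suc n) (k * suc n))) (sym (+-assoc w _ _))) p))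

-- Sumsets in ℤ/N and Olson's theorem.

module Residues (n : ℕ) where

  private
    N : ℕ
    N = suc n

  infixl 6 _⊕_
  _⊕_ : ℕ → ℕ → ℕ
  x ⊕ y = (x + y) % N

  ⊕-< : ∀ x y → x ⊕ y < N
  ⊕-< x y = m%n<n (x + y) N

  %-+ˡ : ∀ x y → (x % N) ⊕ y ≡ x ⊕ y
  %-+ˡ x y = begin
    (x % N + y) % N           ≡⟨ %-distribˡ-+ (x % N) y N ⟩
    (x % N % N + y % N) % N   ≡⟨ cong (λ r → (r + y % N) % N) (m%n%n≡m%n x N) ⟩
    (x % N + y % N) % N       ≡⟨ %-distribˡ-+ x y N ⟨
    (x + y) % N               ∎
    where open ≡-Reasoning

  ⊕-comm : ∀ x y → x ⊕ y ≡ y ⊕ x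
  ⊕-comm x y = cong (_% N) (+-comm x y)

  ⊕-assoc-+ : ∀ x y z → x ⊕ y ⊕ z ≡ (x + (y + z)) % N
  ⊕-assoc-+ x y z = trans (%-+ˡ (x + y) z) (cong (_% N) (+-assoc x y z))

  ⊕-swap : ∀ x y z → x ⊕ y ⊕ z ≡ x ⊕ z ⊕ y
  ⊕-swap x y z = trans (⊕-assoc-+ x y z) (trans (cong (λ w → (x + w) % N) (+-comm y z)) (sym (⊕-assoc-+ x z y)))

  ⊕-identityʳ : ∀ {x} → x < N → x ⊕ 0 ≡ x
  ⊕-identityʳ {x} x<N = trans (cong (_% N) (+-identityʳ x)) (m<n⇒m%n≡m x<N)

  ⊕-cancelˡ : ∀ x {y z} → y < N → z < N → x ⊕ y ≡ x ⊕ z → y ≡ z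
  ⊕-cancelˡ x y<N z<N eq = trans (sym (undo y<N)) (trans (cong (_⊕ n * x) eq) (undo z<N))
    where
    ring : ∀ x w n → x + (w + n * x) ≡ w + x * suc n
    ring = solve-∀
    -- `n * x` acts as the inverse of `x`, because `x + n * x` is a multiple of `N`.
    undo : ∀ {w} → w < N → x ⊕ w ⊕ n * x ≡ w
    undo {w} w<N = trans (⊕-assoc-+ x w (n * x)) (trans (cong (_% N) (ring x w n))
      (trans ([m+kn]%n≡m%n w x N) (m<n⇒m%n≡m w<N)))

  ⊕-cancelʳ : ∀ x {y z} → y < N → z < N → y ⊕ x ≡ z ⊕ x → y ≡ z
  ⊕-cancelʳ x {y} {z} y<N z<N eq = ⊕-cancelˡ x y<N z<N (trans (⊕-comm x y) (trans eq (⊕-comm z x)))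

  _∈_⊞_ : ℕ → List ℕ → List ℕ → Set
  z ∈ A ⊞ B = ∃₂ λ a b → a ∈ A × b ∈ B × a ⊕ b ≡ z

  -- In the finite group ℤ/N this says that the sumset is a union of cosets of the subgroup
  -- generated by `B`.
  Stable : List ℕ → List ℕ → Set
  Stable A B = ∀ {z b} → z ∈ A ⊞ B → b ∈ B → (z ⊕ b) ∈ A ⊞ B

  stable-coset : ∀ {A B} → Stable A B → (e : ℕ) .{{_ : NonZero e}} → e ≡ foldr gcd N B →
    ∀ {z w} → z ∈ A ⊞ B → w < N → w % e ≡ z % e → w ∈ A ⊞ B
  stable-coset {A} {B} st e refl {z} {w} z∈@(a , b , _ , _ , refl) w<N eq =
    subst (_∈ A ⊞ B) (m<n⇒m%n≡m w<N)
      (closed-≡ {P} n down e (gcds∣init N B) (closed-gcds n up down (All.tabulate closed)) {z} {w}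
        (subst (_∈ A ⊞ B) (sym (m%n%n≡m%n (a + b) N)) z∈) eq)
    where
    P : ℕ → Set
    P x = (x % N) ∈ A ⊞ B
    up : Closed P N
    up x = subst (_∈ A ⊞ B) (sym ([m+n]%n≡m%n x N))
    down : ∀ x → P (x + N) → P x
    down x = subst (_∈ A ⊞ B) ([m+n]%n≡m%n x N)
    closed : ∀ {b} → b ∈ B → Closed P b
    closed {b} b∈ x p = subst (_∈ A ⊞ B) (%-+ˡ x b) (st p b∈)

  -- `D` certifies the size of the sumset, which is only a predicate. Keeping `A` inside `D`
  -- preserves the element 0 when growth is iterated, and doubling avoids the fraction in |A| +
  -- |B|/2.
  Grows : List ℕ → List ℕ → Set
  Grows A B = ∃[ D ] Unique D × All (_∈ A ⊞ B) D × (∀ {x} → x ∈ A → x ∈ D) ×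
    2 * length A + length B ≤ 2 * length D

  escape? : ∀ {Q : ℕ → Set} → Decidable Q → (A B : List ℕ) →
    (∃₂ λ a b → a ∈ A × b ∈ B × ¬ Q (a ⊕ b)) ⊎ (∀ {a b} → a ∈ A → b ∈ B → Q (a ⊕ b))
  escape? {Q} Q? A B with all? (λ a → all? (λ b → Q? (a ⊕ b)) B) A
  ... | yes p = inj₂ (λ a∈ b∈ → All.lookup (All.lookup p a∈) b∈)
  ... | no ¬p with find (¬All⇒Any¬ (λ a → all? (λ b → Q? (a ⊕ b)) B) A ¬p)
  ... | a , a∈ , ¬q with find (¬All⇒Any¬ (λ b → Q? (a ⊕ b)) B ¬q)
  ... | b , b∈ , ¬r = inj₁ (a , b , a∈ , b∈ , ¬r)

  -- Olson's theorem; f bounds the recursion.  The e-transform (A, B) ↦ (A ∪ (e ⊕ B), B ∩ (A ⊖ e)) preserves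
  -- |A| + |B| and does not enlarge A ⊞ B.  If it leaves more than half of B and its sumset is periodic, then
  -- either A ⊞ B is a union of cosets, or a coset of ⟨B₁⟩ meeting A moves outside A + ⟨B₁⟩ under some b₀; its
  -- points in A, moved by b₀, and its points outside A are then |B₁| new elements.
  olson : ∀ f A B → length B ≤ f → Unique A → All (_< N) A → Unique B → All (_< N) B → 0 ∈ B →
    Grows A B ⊎ Stable A B
  olson zero A (_ ∷ _) () _ _ _ _ _
  -- The pair found has `e ⊕ b₁` outside `A`, so `b₁` leaves `B` and the recursion is on a shorter
  -- list; 0 remains in it, as `e` lies in `A`.
  olson (suc f) A B lenB uA bA uB bB 0∈B with escape? (_∈? A) A B
  ... | inj₂ stay = inj₂ λ { (a , b , a∈ , b∈ , refl) b′∈ → _ , _ , stay a∈ b∈ , b′∈ , refl }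
  ... | inj₁ (e , b₁ , e∈ , b₁∈ , b₁∉) = dichotomy
    where
    e+? : Decidable (λ b → e ⊕ b ∈ A)
    e+? b = e ⊕ b ∈? A

    B₁ B₂ A₁ : List ℕ
    B₁ = filter e+? B
    B₂ = filter (¬? ∘ e+?) B
    A₁ = A ++ map (e ⊕_) B₂

    B₁⊆B : ∀ {b} → b ∈ B₁ → b ∈ B
    B₁⊆B = proj₁ ∘ ∈-filter⁻ e+?
    B₂⊆B : ∀ {b} → b ∈ B₂ → b ∈ B
    B₂⊆B = proj₁ ∘ ∈-filter⁻ (¬? ∘ e+?)

    uB₁ : Unique B₁
    uB₁ = Unique.filter⁺ e+? uB
    bB₁ : All (_< N) B₁
    bB₁ = All.tabulate (All.lookup bB ∘ B₁⊆B)
    bA′ : ∀ {a} → a ∈ A → a < N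
    bA′ = All.lookup bA
    bB′ : ∀ {b} → b ∈ B → b < N
    bB′ = All.lookup bB
    0∈B₁ : 0 ∈ B₁
    0∈B₁ = ∈-filter⁺ e+? 0∈B (subst (_∈ A) (sym (⊕-identityʳ (bA′ e∈))) e∈)

    split : length B₁ + length B₂ ≡ length B
    split = length-filter-split e+? B

    B₂≥1 : 1 ≤ length B₂
    B₂≥1 = ∈-length (∈-filter⁺ (¬? ∘ e+?) b₁∈ b₁∉)

    lenB₁ : length B₁ ≤ f
    lenB₁ = +-cancelʳ-≤ 1 (length B₁) f (begin
      length B₁ + 1 ≤⟨ +-monoʳ-≤ (length B₁) B₂≥1 ⟩
      length B₁ + length B₂ ≡⟨ split ⟩
      length B ≤⟨ lenB ⟩
      suc f ≡⟨ +-comm 1 f ⟩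
      f + 1 ∎)
      where open ≤-Reasoning

    uA₁ : Unique A₁
    uA₁ = Unique.++⁺ uA
      (unique-map-on (e ⊕_) (λ p q → ⊕-cancelˡ e (bB′ (B₂⊆B p)) (bB′ (B₂⊆B q)))
        (Unique.filter⁺ (¬? ∘ e+?) uB))
      λ { (p , q) → let b , b∈ , eq = ∈-map⁻ (e ⊕_) q in
            proj₂ (∈-filter⁻ (¬? ∘ e+?) {xs = B} b∈) (subst (_∈ A) eq p) }

    bA₁ : All (_< N) A₁
    bA₁ = All.tabulate λ z∈ → case₁ (∈-++⁻ A z∈)
      where
      case₁ : ∀ {z} → z ∈ A ⊎ z ∈ map (e ⊕_) B₂ → z < N
      case₁ (inj₁ p) = bA′ p
      case₁ (inj₂ q) with b , _ , refl ← ∈-map⁻ (e ⊕_) q = ⊕-< e b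

    lenA₁ : length A₁ ≡ length A + length B₂
    lenA₁ = trans (length-++ A) (cong (length A +_) (length-map (e ⊕_) B₂))

    A⊆A+B : ∀ {a} → a ∈ A → a ∈ A ⊞ B
    A⊆A+B a∈ = _ , 0 , a∈ , 0∈B , ⊕-identityʳ (bA′ a∈)

    A₁⊆A+B : ∀ {z} → z ∈ A₁ → z ∈ A ⊞ B
    A₁⊆A+B z∈ with ∈-++⁻ A z∈
    ... | inj₁ p = A⊆A+B p
    ... | inj₂ q with b , b∈ , refl ← ∈-map⁻ (e ⊕_) q = e , b , e∈ , B₂⊆B b∈ , refl

    shrink : ∀ {z} → z ∈ A₁ ⊞ B₁ → z ∈ A ⊞ B
    shrink (a , b , a∈ , b∈ , refl) with ∈-++⁻ A a∈
    ... | inj₁ p = a , b , p , B₁⊆B b∈ , refl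
    ... | inj₂ q with b₂ , b₂∈ , refl ← ∈-map⁻ (e ⊕_) q =
      e ⊕ b , b₂ , proj₂ (∈-filter⁻ e+? {xs = B} b∈) , B₂⊆B b₂∈ , ⊕-swap e b b₂

    dichotomy : Grows A B ⊎ Stable A B
    dichotomy with 2 * length B₁ ≤? length B
    -- At least half of `B` was moved, so `A₁` alone has the |B|/2 new elements.
    ... | yes small = inj₁ (A₁ , uA₁ , All.tabulate A₁⊆A+B , ∈-++⁺ˡ , (begin
      2 * length A + length B ≤⟨ +-monoʳ-≤ (2 * length A) half ⟩
      2 * length A + 2 * length B₂ ≡⟨ *-distribˡ-+ 2 (length A) (length B₂) ⟨
      2 * (length A + length B₂) ≡⟨ cong (2 *_) lenA₁ ⟨
      2 * length A₁ ∎))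
      where
      open ≤-Reasoning
      half : length B ≤ 2 * length B₂
      half = +-cancelˡ-≤ (length B) _ _ (begin
        length B + length B ≡⟨ cong (length B +_) (+-identityʳ (length B)) ⟨
        2 * length B ≡⟨ cong (2 *_) split ⟨
        2 * (length B₁ + length B₂) ≡⟨ *-distribˡ-+ 2 (length B₁) (length B₂) ⟩
        2 * length B₁ + 2 * length B₂ ≤⟨ +-monoˡ-≤ _ small ⟩
        length B + 2 * length B₂ ∎)
    ... | no big with olson f A₁ B₁ lenB₁ uA₁ bA₁ uB₁ bB₁ 0∈B₁
    ... | inj₁ (D , uD , D⊆ , A₁⊆D , lenD) =
      inj₁ (D , uD , All.map shrink D⊆ , A₁⊆D ∘ ∈-++⁺ˡ , (begin
        2 * length A + length B ≡⟨ cong (2 * length A +_) split ⟨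
        2 * length A + (length B₁ + length B₂) ≤⟨ m≤m+n _ (length B₂) ⟩
        2 * length A + (length B₁ + length B₂) + length B₂ ≡⟨ ring (length A) (length B₁) (length B₂) ⟩
        2 * (length A + length B₂) + length B₁ ≡⟨ cong (λ k → 2 * k + length B₁) lenA₁ ⟨
        2 * length A₁ + length B₁ ≤⟨ lenD ⟩
        2 * length D ∎))
      where
      open ≤-Reasoning
      ring : ∀ a x y → 2 * a + (x + y) + y ≡ 2 * (a + y) + x
      ring = solve-∀
    ... | inj₂ stable = cosets (escape? (λ z → any? (λ a → z % g ≟ a % g) A) A B)
      where
      g : ℕ
      g = foldr gcd N B₁
      g∣N : g ∣ N
      g∣N = gcds∣init N B₁
      instance
        g≢0 : NonZero g
        g≢0 = ∣-nonZero g∣N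
      -- `Q` describes A + ⟨B₁⟩. Each of its cosets meets `A`, hence `A₁ ⊞ B₁`, and so lies in
      -- `A ⊞ B` by stability.
      Q : ℕ → Set
      Q z = Any (λ a → z % g ≡ a % g) A
      ⊕-%g : ∀ x y → (x ⊕ y) % g ≡ (x % g + y) % g
      ⊕-%g x y = begin
        (x + y) % N % g         ≡⟨ %-%-∣ (x + y) g∣N ⟩
        (x + y) % g             ≡⟨ %-distribˡ-+ x y g ⟩
        (x % g + y % g) % g     ≡⟨ cong (λ r → (r + y % g) % g) (m%n%n≡m%n x g) ⟨
        (x % g % g + y % g) % g ≡⟨ %-distribˡ-+ (x % g) y g ⟨
        (x % g + y) % g         ∎
        where open ≡-Reasoning
      B₁-%g : ∀ x {b} → b ∈ B₁ → (x ⊕ b) % g ≡ x % g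
      B₁-%g x {b} b∈ = trans (%-%-∣ (x + b) g∣N) (%-remove-+ʳ x (All.lookup (gcds∣all N B₁) b∈))
      Q⊆A+B : ∀ {z} → z < N → Q z → z ∈ A ⊞ B
      Q⊆A+B z<N q with a , a∈ , eq ← find q = shrink (stable-coset stable g refl
        (a , 0 , ∈-++⁺ˡ a∈ , 0∈B₁ , ⊕-identityʳ (bA′ a∈)) z<N eq)
      cosets : _ → Grows A B ⊎ Stable A B
      -- Here A + B stays inside A + ⟨B₁⟩, so the two are equal, and this union of cosets is closed
      -- under adding `B`.
      cosets (inj₂ stay) = inj₂ λ { {z} {b} (a , b′ , a∈ , b′∈ , refl) b∈ →
        let c , c∈ , eq = find (stay a∈ b′∈)
            q = stay c∈ b∈
        in Q⊆A+B (⊕-< z b) (subst (λ r → Any (λ x → r ≡ x % g) A)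
             (trans (⊕-%g c b) (trans (cong (λ r → (r + b) % g) (sym eq)) (sym (⊕-%g z b)))) q) }
      cosets (inj₁ (a₀ , b₀ , a₀∈ , b₀∈ , out)) = inj₁ (A ++ map φ B₁ ,
        Unique.++⁺ uA (unique-map-on φ φ-inj uB₁)
          (λ { (p , q) → let b , b∈ , eq = ∈-map⁻ φ q in φ∉A b∈ (subst (_∈ A) eq p) }) ,
        All.tabulate (λ z∈ → D⊆ (∈-++⁻ A z∈)) , ∈-++⁺ˡ , (begin
          2 * length A + length B ≤⟨ +-monoʳ-≤ (2 * length A) (<⇒≤ (≰⇒> big)) ⟩
          2 * length A + 2 * length B₁ ≡⟨ *-distribˡ-+ 2 (length A) (length B₁) ⟨
          2 * (length A + length B₁) ≡⟨ cong (λ k → 2 * (length A + k)) (length-map φ B₁) ⟨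
          2 * (length A + length (map φ B₁)) ≡⟨ cong (2 *_) (length-++ A) ⟨
          2 * length (A ++ map φ B₁) ∎))
        where
        open ≤-Reasoning
        φ : ℕ → ℕ
        φ b with a₀ ⊕ b ∈? A
        ... | yes _ = a₀ ⊕ b ⊕ b₀
        ... | no _ = a₀ ⊕ b
        moved∉Q : ∀ {b} → b ∈ B₁ → ¬ Q (a₀ ⊕ b ⊕ b₀)
        moved∉Q {b} b∈ q = out (subst (λ r → Any (λ x → r ≡ x % g) A)
          (trans (cong (_% g) (⊕-swap a₀ b b₀)) (B₁-%g (a₀ ⊕ b₀) b∈)) q)
        near∈Q : ∀ {b} → b ∈ B₁ → Q (a₀ ⊕ b)
        near∈Q b∈ = lose a₀∈ (B₁-%g a₀ b∈)
        φ∉A : ∀ {b} → b ∈ B₁ → φ b ∉ A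
        φ∉A {b} b∈ with a₀ ⊕ b ∈? A
        ... | yes _ = λ p → moved∉Q b∈ (lose p refl)
        ... | no ∉A = ∉A
        φ∈ : ∀ {b} → b ∈ B₁ → φ b ∈ A ⊞ B
        φ∈ {b} b∈ with a₀ ⊕ b ∈? A
        ... | yes p = a₀ ⊕ b , b₀ , p , b₀∈ , refl
        ... | no _ = Q⊆A+B (⊕-< a₀ b) (near∈Q b∈)
        -- Moved points lie outside `Q` and unmoved ones inside, so the two kinds never collide;
        -- within one kind cancellation applies.
        φ-inj : ∀ {x y} → x ∈ B₁ → y ∈ B₁ → φ x ≡ φ y → x ≡ y
        φ-inj {x} {y} x∈ y∈ eq with a₀ ⊕ x ∈? A | a₀ ⊕ y ∈? A
        ... | yes _ | yes _ = ⊕-cancelˡ a₀ (All.lookup bB₁ x∈) (All.lookup bB₁ y∈)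
                                (⊕-cancelʳ b₀ (⊕-< a₀ x) (⊕-< a₀ y) eq)
        ... | yes _ | no _ = ⊥-elim (moved∉Q x∈ (subst Q (sym eq) (near∈Q y∈)))
        ... | no _ | yes _ = ⊥-elim (moved∉Q y∈ (subst Q eq (near∈Q x∈)))
        ... | no _ | no _ = ⊕-cancelˡ a₀ (All.lookup bB₁ x∈) (All.lookup bB₁ y∈) eq
        D⊆ : ∀ {z} → z ∈ A ⊎ z ∈ map φ B₁ → z ∈ A ⊞ B
        D⊆ (inj₁ p) = A⊆A+B p
        D⊆ (inj₂ q) with b , b∈ , refl ← ∈-map⁻ φ q = φ∈ b∈

-- Covering a subgroup of ℤ/N by iterated sums.

module Covering (n : ℕ) where
  open Residues n

  private
    N : ℕ
    N = suc n

  -- Exactly `k` summands; once 0 is in `C` this allows any smaller number as well.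
  IsSum : List ℕ → ℕ → ℕ → Set
  IsSum C k z = ∃[ cs ] length cs ≡ k × All (_∈ C) cs × sum cs % N ≡ z % N

  isSum-⊞ : ∀ {C k D} → All (IsSum C k) D → ∀ {z} → z ∈ D ⊞ C → IsSum C (suc k) z
  isSum-⊞ {C} hD (a , b , a∈ , b∈ , refl) with All.lookup hD a∈
  ... | cs , len , all , eq = b ∷ cs , cong suc len , b∈ ∷ all , (begin
    (b + sum cs) % N ≡⟨ ⊕-comm b (sum cs) ⟩
    (sum cs + b) % N ≡⟨ %-+ˡ (sum cs) b ⟨
    (sum cs % N + b) % N ≡⟨ cong (λ r → (r + b) % N) eq ⟩
    (a % N + b) % N ≡⟨ %-+ˡ a b ⟩
    (a + b) % N ≡⟨ m%n%n≡m%n (a + b) N ⟨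
    (a + b) % N % N ∎)
    where open ≡-Reasoning

  module _ (C : List ℕ) (uC : Unique C) (bC : All (_< N) C) (0∈C : 0 ∈ C) where

    private
      c : ℕ
      c = length C

      c≤N : c ≤ N
      c≤N = unique-<-length uC bC

    -- Each round adds one summand and, by Olson's theorem, at least c/2 residues; the invariant
    -- `2 + k * c ≤ 2 * length D` records this, its 2 coming from the one-element start. As `D` has
    -- at most `N` elements, the fuel suffices and `k * c ≤ 2 * N` when growth stops.
    saturate : ∀ f k D → N < length D + f → 0 ∈ D → Unique D → All (_< N) D → All (IsSum C k) D →
      2 + k * c ≤ 2 * length D →
      ∃₂ λ k D → 0 ∈ D × All (IsSum C k) D × k * c ≤ 2 * N × Stable D C
    saturate zero k D fuel _ uD bD _ _ =
      ⊥-elim (<⇒≱ fuel (subst (_≤ N) (sym (+-identityʳ (length D))) (unique-<-length uD bD)))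
    saturate (suc f) k D fuel 0∈D uD bD sD size with olson (length C) D C ≤-refl uD bD uC bC 0∈C
    ... | inj₂ stable = k , D , 0∈D , sD ,
      ≤-trans (m≤n+m (k * c) 2) (≤-trans size (*-monoʳ-≤ 2 (unique-<-length uD bD))) , stable
    ... | inj₁ (E , uE , E⊆ , D⊆E , grow) = saturate f (suc k) E fuel′ (D⊆E 0∈D) uE bE
      (All.map (isSum-⊞ sD) E⊆) size′
      where
      open ≤-Reasoning
      bE : All (_< N) E
      bE = All.map (λ { (a , b , _ , _ , refl) → ⊕-< a b }) E⊆
      bigger : length D < length E
      bigger = *-cancelˡ-< 2 (length D) (length E) (begin-strict
        2 * length D <⟨ m<m+n (2 * length D) (∈-length 0∈C) ⟩
        2 * length D + c ≤⟨ grow ⟩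
        2 * length E ∎)
      fuel′ : N < length E + f
      fuel′ = begin-strict
        N <⟨ fuel ⟩
        length D + suc f ≡⟨ +-suc (length D) f ⟩
        suc (length D) + f ≤⟨ +-monoˡ-≤ f bigger ⟩
        length E + f ∎
      size′ : 2 + suc k * c ≤ 2 * length E
      size′ = begin
        2 + (c + k * c) ≡⟨ cong (2 +_) (+-comm c (k * c)) ⟩
        2 + (k * c + c) ≡⟨ +-assoc 2 (k * c) c ⟨
        2 + k * c + c ≤⟨ +-monoˡ-≤ c size ⟩
        2 * length D + c ≤⟨ grow ⟩
        2 * length E ∎

    -- One more summand turns the final `D` into `D ⊞ C`, a union of cosets containing 0, hence
    -- containing all multiples of the gcd. This summand adds `c ≤ N` to the bound `2 * N`.
    covering : ∃[ k ] k * c ≤ 3 * N × (∀ z → foldr gcd N C ∣ z → IsSum C k z)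
    covering with saturate N 0 (0 ∷ []) ≤-refl (here refl) ([] ∷ []) (z<s ∷ [])
                    (([] , refl , [] , refl) ∷ []) ≤-refl
    ... | k , D , 0∈D , sD , kc , stable = suc k , (begin
      c + k * c ≤⟨ +-mono-≤ c≤N kc ⟩
      3 * N ∎) , λ z g∣z → let cs , len , all , eq = isSum-⊞ sD (hit z g∣z) in
        cs , len , all , trans eq (m%n%n≡m%n z N)
      where
      open ≤-Reasoning
      g = foldr gcd N C
      instance
        g≢0 : NonZero g
        g≢0 = ∣-nonZero (gcds∣init N C)
      hit : ∀ z → g ∣ z → (z % N) ∈ D ⊞ C
      hit z g∣z = stable-coset stable g refl (0 , 0 , 0∈D , 0∈C , refl) (m%n<n z N)
        (trans (%-%-∣ z (gcds∣init N C)) (trans (n∣m⇒m%n≡0 z g g∣z) (sym (n∣m⇒m%n≡0 0 g (g ∣0)))))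

    -- `C` consists of distinct multiples of `g` below `N`, and there are only N/g of these.
    gcds-bound : foldr gcd N C * c ≤ N
    gcds-bound = begin
      g * c ≤⟨ *-monoʳ-≤ g (unique-⊆-length uC C⊆) ⟩
      g * length (map (_* g) (upTo (N / g))) ≡⟨ cong (g *_) (trans (length-map (_* g) (upTo (N / g))) (length-upTo (N / g))) ⟩
      g * (N / g) ≡⟨ *-comm g (N / g) ⟩
      N / g * g ≤⟨ m/n*n≤m N g ⟩
      N ∎
      where
      open ≤-Reasoning
      g = foldr gcd N C
      instance
        g≢0 : NonZero g
        g≢0 = ∣-nonZero (gcds∣init N C)
      C⊆ : ∀ {x} → x ∈ C → x ∈ map (_* g) (upTo (N / g))
      C⊆ x∈ with All.lookup (gcds∣all N C) x∈
      ... | divides-refl j = ∈-map⁺ (_* g) (∈-upTo⁺ (*-cancelʳ-< g j (N / g)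
        (subst (j * g <_) (sym (m/n*n≡m (gcds∣init N C))) (All.lookup bC x∈))))

-- From residues modulo N to integers.

maxElem-∈ : ∀ x xs → maxElem (x ∷ xs) ∈ x ∷ xs
maxElem-∈ x [] = here (⊔-identityʳ x)
maxElem-∈ x (y ∷ ys) with ⊔-sel x (maxElem (y ∷ ys))
... | inj₁ eq = here eq
... | inj₂ eq = there (subst (_∈ y ∷ ys) (sym eq) (maxElem-∈ y ys))

≤maxElem : ∀ {xs x} → x ∈ xs → x ≤ maxElem xs
≤maxElem (here refl) = m≤m⊔n _ _
≤maxElem {y ∷ ys} (there x∈) = ≤-trans (≤maxElem x∈) (m≤n⊔m y (maxElem ys))

sum-replicate : ∀ j x → sum (replicate j x) ≡ j * x
sum-replicate zero x = refl
sum-replicate (suc j) x = cong (x +_) (sum-replicate j x)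

sum-≤ : ∀ {xs b} → All (_≤ b) xs → sum xs ≤ length xs * b
sum-≤ [] = z≤n
sum-≤ (p ∷ ps) = +-mono-≤ p (sum-≤ ps)

-- The 0 that made the number of summands flexible is not itself an available sum, so it is removed
-- again.
drop-zeros : ∀ {B : List ℕ} cs → All (_∈ 0 ∷ B) cs →
  ∃[ bs ] All (_∈ B) bs × sum bs ≡ sum cs × length bs ≤ length cs
drop-zeros [] [] = [] , [] , refl , z≤n
drop-zeros (c ∷ cs) (p ∷ ps) with drop-zeros cs ps | p
... | bs , all , eq , le | here refl = bs , all , eq , m≤n⇒m≤1+n le
... | bs , all , eq , le | there c∈ = c ∷ bs , c∈ ∷ all , cong (c +_) eq , s≤s le

∈-replicate⁻ : ∀ j {x y : ℕ} → x ∈ replicate j y → x ≡ y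
∈-replicate⁻ (suc j) (here e) = e
∈-replicate⁻ (suc j) (there p) = ∈-replicate⁻ j p

-- The gap between `sum bs` and `z` is a multiple of `suc n`, and copies of `suc n`, itself in `B`,
-- fill it.
fill-multiples : ∀ n {B k z} bs → All (_∈ B) bs → suc n ∈ B → length bs ≤ k → sum bs % suc n ≡ z % suc n → sum bs ≤ z →
  ∃[ bs′ ] All (_∈ B) bs′ × sum bs′ ≡ z × length bs′ * suc n ≤ k * suc n + z
fill-multiples n {B} {k} {z} bs bs⊆ N∈ len eqN le = bs ++ replicate j N ,
    All.tabulate (λ x∈ → member (∈-++⁻ bs x∈)) , sum≡ , (begin
  length (bs ++ replicate j N) * N ≡⟨ cong (_* N) (trans (length-++ bs) (cong (length bs +_) (length-replicate j {N}))) ⟩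
  (length bs + j) * N ≡⟨ *-distribʳ-+ N (length bs) j ⟩
  length bs * N + j * N ≤⟨ +-mono-≤ (*-monoˡ-≤ N len) jN≤z ⟩
  k * N + z ∎)
  where
  open ≤-Reasoning
  N : ℕ
  N = suc n
  N∣ : N ∣ z ∸ sum bs
  N∣ = %≡⇒∣∸ {z} {sum bs} N (sym eqN)
  j : ℕ
  j = quotient N∣
  jN : j * N ≡ z ∸ sum bs
  jN = sym (m∣n⇒n≡quotient*m N∣)
  jN≤z : j * N ≤ z
  jN≤z = subst (_≤ z) (sym jN) (m∸n≤m z (sum bs))
  sum≡ : sum (bs ++ replicate j N) ≡ z
  sum≡ = trans (sum-++ bs _) (trans (cong (sum bs +_) (trans (sum-replicate j N) jN)) (m+[n∸m]≡n le))
  member : ∀ {x} → x ∈ bs ⊎ x ∈ replicate j N → x ∈ B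
  member (inj₁ p) = All.lookup bs⊆ p
  member (inj₂ q) = subst (_∈ B) (sym (∈-replicate⁻ j q)) N∈

-- In the field names β is |B|. Both `d` and `k₀` are of order at most N/|B|. Every bound is stated
-- as a product, so that no division occurs.
record Progression (B : List ℕ) : Set where
  field
    N d k₀ : ℕ
    N∈B : N ∈ B
    d>0 : 0 < d
    d*β≤N : d * length B ≤ N
    β≤N : length B ≤ N
    k₀*β≤3N : k₀ * length B ≤ 3 * N
    represent : ∀ z → d ∣ z → k₀ * N ≤ z →
      ∃[ bs ] All (_∈ B) bs × sum bs ≡ z × length bs * N ≤ k₀ * N + z

progression : ∀ b₀ B₀ → Unique (b₀ ∷ B₀) → All (0 <_) (b₀ ∷ B₀) → Progression (b₀ ∷ B₀)
progression b₀ B₀ uB posB = go (maxElem B) refl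
  where
  B = b₀ ∷ B₀
  max∈ : maxElem B ∈ B
  max∈ = maxElem-∈ b₀ B₀
  -- The maximum is generalised to a variable so that it can be matched against `suc n`, the form of
  -- a modulus in `Residues`.
  go : ∀ N → N ≡ maxElem B → Progression B
  go zero eq with () ← subst (0 <_) (sym eq) (All.lookup posB max∈)
  go (suc n) eq = record
    { N = N ; d = g ; k₀ = k₀ ; N∈B = N∈
    ; d>0 = >-nonZero⁻¹ g {{∣-nonZero (gcds∣init N C)}}
    ; d*β≤N = ≤-trans (*-monoʳ-≤ g β≤c) (gcds-bound C uC bC (here refl))
    ; β≤N = ≤-trans β≤c (unique-<-length uC bC)
    ; k₀*β≤3N = ≤-trans (*-monoʳ-≤ k₀ β≤c) (proj₁ (proj₂ cov))
    ; represent = represent }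
    where
    open Residues n
    open Covering n
    N = suc n
    -- This is `B` modulo `N`: the maximum becomes 0, so no element is lost.
    C = 0 ∷ filter (_<? N) B
    g = foldr gcd N C
    N∈ : N ∈ B
    N∈ = subst (_∈ B) (sym eq) max∈
    uC : Unique C
    uC = All.tabulate (λ x∈ 0≡x → <⇒≢ (All.lookup posB (proj₁ (∈-filter⁻ (_<? N) x∈))) 0≡x)
      ∷ Unique.filter⁺ (_<? N) uB
    bC : All (_< N) C
    bC = z<s ∷ All.tabulate (λ x∈ → proj₂ (∈-filter⁻ (_<? N) {xs = B} x∈))
    β≤c : length B ≤ length C
    β≤c = unique-⊆-length {ys = N ∷ filter (_<? N) B} uB sub
      where
      sub : ∀ {x} → x ∈ B → x ∈ N ∷ filter (_<? N) B
      sub {x} x∈ with x ≟ N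
      ... | yes refl = here refl
      ... | no ≢N = there (∈-filter⁺ (_<? N) x∈ (≤∧≢⇒< (subst (x ≤_) (sym eq) (≤maxElem x∈)) ≢N))
    cov = covering C uC bC (here refl)
    k₀ = proj₁ cov
    represent : ∀ z → g ∣ z → k₀ * N ≤ z →
      ∃[ bs ] All (_∈ B) bs × sum bs ≡ z × length bs * N ≤ k₀ * N + z
    represent z g∣z kN≤z =
      let cs , len , cs⊆ , eqN = proj₂ (proj₂ cov) z g∣z
          bs , bs⊆ , sum-bs , len-bs = drop-zeros cs cs⊆
          cs≤ = ≤-trans (sum-≤ (All.map (λ c∈ → <⇒≤ (All.lookup bC c∈)) cs⊆)) (≤-reflexive (cong (_* N) len))
      in fill-multiples n bs (All.map (λ b∈ → proj₁ (∈-filter⁻ (_<? N) {xs = B} b∈)) bs⊆) N∈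
           (≤-trans len-bs (≤-reflexive len))
           (trans (cong (_% N) sum-bs) eqN) (≤-trans (≤-reflexive sum-bs) (≤-trans cs≤ kN≤z))

-- Multiplicities and sub-multisets.

mult-++ : ∀ v xs ys → mult v (xs ++ ys) ≡ mult v xs + mult v ys
mult-++ v xs ys = trans (cong length (filter-++ (_≟ v) xs ys)) (length-++ (filter (_≟ v) xs))

mult-↭ : ∀ v {xs ys} → xs ↭ ys → mult v xs ≡ mult v ys
mult-↭ v p = ↭-length (filter-↭ (_≟ v) p)

mult-here : ∀ v xs → mult v (v ∷ xs) ≡ suc (mult v xs)
mult-here v xs = cong length (filter-accept (_≟ v) refl)

mult-there : ∀ {v x} xs → x ≢ v → mult v (x ∷ xs) ≡ mult v xs
mult-there {v} xs x≢v = cong length (filter-reject (_≟ v) x≢v)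

mult-∉ : ∀ {v xs} → v ∉ xs → mult v xs ≡ 0
mult-∉ {v} v∉ = cong length (filter-none (_≟ v) (All.tabulate λ x∈ x≡v → v∉ (subst (_∈ _) x≡v x∈)))

mult-∷-≤ : ∀ v x xs → mult v xs ≤ mult v (x ∷ xs)
mult-∷-≤ v x xs with x ≟ v
... | yes refl = ≤-trans (n≤1+n _) (≤-reflexive (sym (mult-here x xs)))
... | no x≢v = ≤-reflexive (sym (mult-there xs x≢v))

mult-mono : ∀ v {xs ys} → xs ⊆ ys → mult v xs ≤ mult v ys
mult-mono v [] = z≤n
mult-mono v {xs} {y ∷ ys} (.y ∷ʳ p) = ≤-trans (mult-mono v p) (mult-∷-≤ v y ys)
mult-mono v {x ∷ xs} {_ ∷ ys} (refl ∷ p) with x ≟ v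
... | yes refl = subst₂ _≤_ (sym (mult-here x xs)) (sym (mult-here x ys)) (s≤s (mult-mono v p))
... | no x≢v = subst₂ _≤_ (sym (mult-there xs x≢v)) (sym (mult-there ys x≢v)) (mult-mono v p)

extract : ∀ {x : ℕ} {xs} → x ∈ xs → ∃[ ys ] xs ↭ x ∷ ys
extract {x} x∈ with ys , zs , refl ← ∈-∃++ x∈ = ys ++ zs , shift x ys zs

-- Only positive values are compared: the pairs drawn from V ∪ {0} contribute zeros, which do not
-- change the sum.
embed : ∀ X Y → (∀ v → 0 < v → mult v Y ≤ mult v X) → InSubsetSums (sum Y) X
embed [] Y le = [] , [] , sym (all-zero Y le)
  where
  all-zero : ∀ Y → (∀ v → 0 < v → mult v Y ≤ 0) → sum Y ≡ 0
  all-zero [] _ = refl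
  all-zero (zero ∷ Y) le = all-zero Y λ { (suc v) p → le (suc v) p }
  all-zero (suc y ∷ Y) le with () ← subst (_≤ 0) (mult-here (suc y) Y) (le (suc y) z<s)
embed (x ∷ X) Y le with x ∈? Y
... | yes x∈Y =
  let Y₁ , Y↭ = extract x∈Y
      Z , Z⊆X , eq = embed X Y₁ (λ v v>0 → drop-x v (x ≟ v) Y↭ (le v v>0))
  in x ∷ Z , refl ∷ Z⊆X , trans (cong (x +_) eq) (sym (sum-↭ Y↭))
  where
  drop-x : ∀ v {Y₁} → Dec (x ≡ v) → Y ↭ x ∷ Y₁ → mult v Y ≤ mult v (x ∷ X) → mult v Y₁ ≤ mult v X
  drop-x v {Y₁} (yes refl) Y↭ h = s≤s⁻¹ (begin
    suc (mult v Y₁) ≡⟨ mult-here v Y₁ ⟨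
    mult v (v ∷ Y₁) ≡⟨ mult-↭ v Y↭ ⟨
    mult v Y ≤⟨ h ⟩
    mult v (v ∷ X) ≡⟨ mult-here v X ⟩
    suc (mult v X) ∎)
    where open ≤-Reasoning
  drop-x v {Y₁} (no x≢v) Y↭ h = begin
    mult v Y₁ ≡⟨ mult-there Y₁ x≢v ⟨
    mult v (x ∷ Y₁) ≡⟨ mult-↭ v Y↭ ⟨
    mult v Y ≤⟨ h ⟩
    mult v (x ∷ X) ≡⟨ mult-there X x≢v ⟩
    mult v X ∎
    where open ≤-Reasoning
... | no x∉Y =
  let Z , Z⊆X , eq = embed X Y skip in Z , x ∷ʳ Z⊆X , eq
  where
  skip : ∀ v → 0 < v → mult v Y ≤ mult v X
  skip v v>0 with x ≟ v
  ... | yes refl = ≤-trans (≤-reflexive (mult-∉ x∉Y)) z≤n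
  ... | no x≢v = ≤-trans (le v v>0) (≤-reflexive (mult-there X x≢v))

-- Members of `R` may lie in the other part of `X`; those not found in `O` are skipped, which is why
-- multiplicities are truncated and the sums are related by an inequality.
difference : ∀ O R → ∃[ O′ ] (∀ v → mult v O′ ≡ mult v O ∸ mult v R) × sum O ≤ sum O′ + sum R ×
  (∀ {x} → x ∈ O′ → x ∈ O)
difference O [] = O , (λ v → refl) , m≤m+n (sum O) 0 , id
difference O (r ∷ R) with difference O R
... | O₁ , mult₁ , sum₁ , sub₁ with r ∈? O₁
... | yes r∈ = O₂ , mult₂ , (begin
    sum O ≤⟨ sum₁ ⟩
    sum O₁ + sum R ≡⟨ cong (_+ sum R) (sum-↭ O₁↭) ⟩
    r + sum O₂ + sum R ≡⟨ cong (_+ sum R) (+-comm r (sum O₂)) ⟩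
    sum O₂ + r + sum R ≡⟨ +-assoc (sum O₂) r (sum R) ⟩
    sum O₂ + (r + sum R) ∎) , λ x∈ → sub₁ (∈-resp-↭ (↭-sym O₁↭) (there x∈))
  where
  open ≤-Reasoning
  O₂ = proj₁ (extract r∈)
  O₁↭ : O₁ ↭ r ∷ O₂
  O₁↭ = proj₂ (extract r∈)
  mult₂ : ∀ v → mult v O₂ ≡ mult v O ∸ mult v (r ∷ R)
  mult₂ v with r ≟ v
  ... | yes refl = begin-equality
    mult v O₂ ≡⟨ cong (_∸ 1) (mult-here v O₂) ⟨
    mult v (v ∷ O₂) ∸ 1 ≡⟨ cong (_∸ 1) (mult-↭ v O₁↭) ⟨
    mult v O₁ ∸ 1 ≡⟨ cong (_∸ 1) (mult₁ v) ⟩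
    mult v O ∸ mult v R ∸ 1 ≡⟨ ∸-+-assoc (mult v O) (mult v R) 1 ⟩
    mult v O ∸ (mult v R + 1) ≡⟨ cong (mult v O ∸_) (trans (+-comm (mult v R) 1) (sym (mult-here v R))) ⟩
    mult v O ∸ mult v (v ∷ R) ∎
  ... | no r≢v = begin-equality
    mult v O₂ ≡⟨ mult-there O₂ r≢v ⟨
    mult v (r ∷ O₂) ≡⟨ mult-↭ v O₁↭ ⟨
    mult v O₁ ≡⟨ mult₁ v ⟩
    mult v O ∸ mult v R ≡⟨ cong (mult v O ∸_) (mult-there R r≢v) ⟨
    mult v O ∸ mult v (r ∷ R) ∎
... | no r∉ = O₁ , mult₂ , ≤-trans sum₁ (+-monoʳ-≤ (sum O₁) (m≤n+m (sum R) r)) , sub₁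
  where
  mult₂ : ∀ v → mult v O₁ ≡ mult v O ∸ mult v (r ∷ R)
  mult₂ v with r ≟ v
  ... | yes refl = begin-equality
    mult v O₁ ≡⟨ mult-∉ r∉ ⟩
    0 ≡⟨ m≤n⇒m∸n≡0 (≤-trans (m∸n≡0⇒m≤n (trans (sym (mult₁ v)) (mult-∉ r∉))) (mult-∷-≤ v v R)) ⟨
    mult v O ∸ mult v (v ∷ R) ∎
    where open ≤-Reasoning
  ... | no r≢v = trans (mult₁ v) (cong (mult v O ∸_) (sym (mult-there R r≢v)))

-- Complements and greedy extension.

complement : ∀ {Y X : List ℕ} → Y ⊆ X → ∃[ Z ] Z ⊆ X × sum Y + sum Z ≡ sum X
complement [] = [] , [] , refl
complement {Y} (x ∷ʳ p) with Z , q , eq ← complement p = x ∷ Z , refl ∷ q ,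
  trans (trans (sym (+-assoc (sum Y) x (sum Z))) (trans (cong (_+ sum Z) (+-comm (sum Y) x)) (+-assoc x _ _))) (cong (x +_) eq)
complement {x ∷ Y} (refl ∷ p) with Z , q , eq ← complement p = Z , x ∷ʳ q , trans (+-assoc x _ _) (cong (x +_) eq)

-- A window of `m` consecutive values is extended by `o ≤ m` without a gap: a target beyond the
-- reach of the remaining elements is at least `u + o`, so `o` can be subtracted from it.
greedy : ∀ {m} O → All (_≤ m) O → ∀ u y → u ≤ y → y < u + m + sum O →
  ∃₂ λ O₁ z → O₁ ⊆ O × u ≤ z × z < u + m × z + sum O₁ ≡ y
greedy {m} [] [] u y u≤y y< = [] , y , [] , u≤y , subst (y <_) (+-identityʳ (u + m)) y< , +-identityʳ y
greedy {m} (o ∷ O) (o≤m ∷ O≤m) u y u≤y y< with y <? u + m + sum O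
... | yes y<′ with O₁ , z , O₁⊆ , rest ← greedy O O≤m u y u≤y y<′ = O₁ , z , o ∷ʳ O₁⊆ , rest
... | no y≮ = let O₁ , z , O₁⊆ , u≤z , z< , eq = greedy O O≤m u (y ∸ o) u≤y∸o y∸o< in
    o ∷ O₁ , z , refl ∷ O₁⊆ , u≤z , z< , (begin-equality
      z + (o + sum O₁) ≡⟨ cong (z +_) (+-comm o (sum O₁)) ⟩
      z + (sum O₁ + o) ≡⟨ +-assoc z (sum O₁) o ⟨
      z + sum O₁ + o ≡⟨ cong (_+ o) eq ⟩
      y ∸ o + o ≡⟨ m∸n+n≡m o≤y ⟩
      y ∎)
  where
  open ≤-Reasoning
  u+o≤y : u + o ≤ y
  u+o≤y = begin
    u + o ≤⟨ +-monoʳ-≤ u o≤m ⟩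
    u + m ≤⟨ m≤m+n (u + m) (sum O) ⟩
    u + m + sum O ≤⟨ ≮⇒≥ y≮ ⟩
    y ∎
  o≤y : o ≤ y
  o≤y = ≤-trans (m≤n+m o u) u+o≤y
  u≤y∸o : u ≤ y ∸ o
  u≤y∸o = m+n≤o⇒m≤o∸n u u+o≤y
  y∸o< : y ∸ o < u + m + sum O
  y∸o< = +-cancelʳ-< o _ _ (begin-strict
    y ∸ o + o ≡⟨ m∸n+n≡m o≤y ⟩
    y <⟨ y< ⟩
    u + m + (o + sum O) ≡⟨ cong (u + m +_) (+-comm o (sum O)) ⟩
    u + m + (sum O + o) ≡⟨ +-assoc (u + m) (sum O) o ⟨
    u + m + sum O + o ∎)

-- Few elements whose subset sums cover ℤ/d.

module ResidueCover (n : ℕ) (X : List ℕ) (spread : ∀ e → 1 < e → suc n ≤ length (notDivBy e X)) where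
  open Residues n

  private
    d : ℕ
    d = suc n

    Hit : List ℕ → ℕ → Set
    Hit R s = ∃[ R₁ ] R₁ ⊆ R × sum R₁ % d ≡ s % d

    -- Elements move from `Z` to `R` only when they bring a new residue into `D`, so |R| < |D| ≤ d.
    -- When no move helps, `D` is closed under adding `Z`, hence under the gcd of `d` and `Z`, which
    -- turns out to be 1.
    extend : ∀ f R Z D → d < length D + f → X ↭ R ++ Z → Unique D → All (_< d) D → All (Hit R) D →
      0 ∈ D → length R < length D → ∃₂ λ R Z → X ↭ R ++ Z × length R < d × (∀ z → Hit R z)
    extend zero R Z D fuel _ uD bD _ _ _ =
      ⊥-elim (<⇒≱ fuel (subst (_≤ d) (sym (+-identityʳ (length D))) (unique-<-length uD bD)))
    extend (suc f) R Z D fuel X↭ uD bD hD 0∈D R<D with escape? (_∈? D) D Z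
    ... | inj₁ (s , x , s∈ , x∈ , out) = let Z₁ , Z↭ = extract x∈ in
      extend f (x ∷ R) Z₁ (s ⊕ x ∷ D) (subst (d <_) (+-suc (length D) f) fuel)
        (↭-trans X↭ (↭-trans (++⁺ˡ R Z↭) (shift x R Z₁)))
        (All.tabulate (λ z∈ eq → out (subst (_∈ D) (sym eq) z∈)) ∷ uD)
        (⊕-< s x ∷ bD) (new ∷ All.map (λ (R₁ , R₁⊆ , eq) → R₁ , x ∷ʳ R₁⊆ , eq) hD)
        (there 0∈D) (s≤s R<D)
      where
      new : Hit (x ∷ R) (s ⊕ x)
      new with R₁ , R₁⊆ , eq ← All.lookup hD s∈ = x ∷ R₁ , refl ∷ R₁⊆ , (begin
        (x + sum R₁) % d ≡⟨ ⊕-comm x (sum R₁) ⟩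
        (sum R₁ + x) % d ≡⟨ %-+ˡ (sum R₁) x ⟨
        (sum R₁ % d + x) % d ≡⟨ cong (λ r → (r + x) % d) eq ⟩
        (s % d + x) % d ≡⟨ %-+ˡ s x ⟩
        (s + x) % d ≡⟨ m%n%n≡m%n (s + x) d ⟨
        (s + x) % d % d ∎)
        where open ≡-Reasoning
    ... | inj₂ stay = R , Z , X↭ , R<d , λ z →
          let R₁ , R₁⊆ , eq = All.lookup hD (everything z) in R₁ , R₁⊆ , trans eq (m%n%n≡m%n z d)
      where
      R<d : length R < d
      R<d = ≤-trans R<D (unique-<-length uD bD)
      P : ℕ → Set
      P x = x % d ∈ D
      up : Closed P d
      up x = subst (_∈ D) (sym ([m+n]%n≡m%n x d))
      down : ∀ x → P (x + d) → P x
      down x = subst (_∈ D) ([m+n]%n≡m%n x d)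
      g : ℕ
      g = foldr gcd d Z
      closed-g : Closed P g
      closed-g = closed-gcds n up down (All.tabulate λ {x} x∈ s p → subst (_∈ D) (%-+ˡ s x) (stay p x∈))
      -- `g` divides everything outside `R`, so all elements it fails to divide are among the fewer
      -- than `d` elements of `R`, against `spread`.
      g≯1 : ¬ 1 < g
      g≯1 1<g = <⇒≱ R<d (begin
        d ≤⟨ spread g 1<g ⟩
        length (notDivBy g X) ≡⟨ ↭-length (filter-↭ (λ x → ¬? (g ∣? x)) X↭) ⟩
        length (notDivBy g (R ++ Z)) ≡⟨ cong length (filter-++ (λ x → ¬? (g ∣? x)) R Z) ⟩
        length (notDivBy g R ++ notDivBy g Z) ≡⟨ length-++ (notDivBy g R) ⟩
        length (notDivBy g R) + length (notDivBy g Z) ≡⟨ cong (λ l → length (notDivBy g R) + length l)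
          (filter-none (λ x → ¬? (g ∣? x)) (All.map (λ g∣x g∤x → g∤x g∣x) (gcds∣all d Z))) ⟩
        length (notDivBy g R) + 0 ≡⟨ +-identityʳ _ ⟩
        length (notDivBy g R) ≤⟨ length-filter (λ x → ¬? (g ∣? x)) R ⟩
        length R ∎)
        where open ≤-Reasoning
      g≡1 : g ≡ 1
      g≡1 = ≤-antisym (≮⇒≥ g≯1) (>-nonZero⁻¹ g {{∣-nonZero (gcds∣init d Z)}})
      everything : ∀ z → P z
      everything z = closed-≡ {P} n down 1 (1∣ d) (subst (Closed P) g≡1 closed-g) {0} {z} 0∈D
        (trans (n%1≡0 z) (sym (n%1≡0 0)))

  residue-cover : ∃₂ λ R Z → X ↭ R ++ Z × length R < d × (∀ z → ∃[ R₁ ] R₁ ⊆ R × sum R₁ % d ≡ z % d)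
  residue-cover = extend d [] X (0 ∷ []) ≤-refl ↭-refl ([] ∷ []) (z<s ∷ []) (([] , [] , refl) ∷ [])
    (here refl) z<s

-- Finite sums and dyadic pigeonholing.

sumBelow : ℕ → (ℕ → ℕ) → ℕ
sumBelow zero F = 0
sumBelow (suc h) F = sumBelow h F + F h

sumBelow-cong : ∀ h {F G} → (∀ i → F i ≡ G i) → sumBelow h F ≡ sumBelow h G
sumBelow-cong zero eq = refl
sumBelow-cong (suc h) eq = cong₂ _+_ (sumBelow-cong h eq) (eq h)

sumBelow-+ : ∀ h F G → sumBelow h (λ i → F i + G i) ≡ sumBelow h F + sumBelow h G
sumBelow-+ zero F G = refl
sumBelow-+ (suc h) F G = trans (cong (_+ (F h + G h)) (sumBelow-+ h F G)) (ring (sumBelow h F) (sumBelow h G) (F h) (G h))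
  where
  ring : ∀ a b c d → a + b + (c + d) ≡ a + c + (b + d)
  ring = solve-∀

sumBelow-* : ∀ h c F → sumBelow h (λ i → c * F i) ≡ c * sumBelow h F
sumBelow-* zero c F = sym (*-zeroʳ c)
sumBelow-* (suc h) c F = trans (cong (_+ c * F h) (sumBelow-* h c F)) (sym (*-distribˡ-+ c _ (F h)))

sumBelow-const : ∀ h c → sumBelow h (λ _ → c) ≡ h * c
sumBelow-const zero c = refl
sumBelow-const (suc h) c = trans (cong (_+ c) (sumBelow-const h c)) (+-comm (h * c) c)

sumBelow-2^ : ∀ h → suc (sumBelow h (2 ^_)) ≡ 2 ^ h
sumBelow-2^ zero = refl
sumBelow-2^ (suc h) = trans (cong (_+ 2 ^ h) (sumBelow-2^ h)) (cong (2 ^ h +_) (sym (+-identityʳ (2 ^ h))))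

sumBelow-pigeonhole : ∀ h F G → 0 < h → sumBelow h G ≤ sumBelow h F → ∃[ i ] i < h × G i ≤ F i
sumBelow-pigeonhole (suc h) F G _ le with G h ≤? F h
... | yes p = h , ≤-refl , p
... | no ¬p with h
...   | zero = ⊥-elim (¬p le)
...   | suc h′ = let i , i< , p = sumBelow-pigeonhole (suc h′) F G z<s
                                    (+-cancelʳ-≤ (F (suc h′)) _ _ (≤-trans (+-monoʳ-≤ _ (<⇒≤ (≰⇒> ¬p))) le))
                 in i , m<n⇒m<1+n i< , p

-- The levels are nested, not disjoint: only a lower bound on `f` is imposed.
level : (ℕ → ℕ) → List ℕ → ℕ → List ℕ
level f xs i = filter (λ s → 2 ^ i ≤? f s) xs

private
  -- Not a binary digit: it is 1 at every position up to the leading one. If that position is k, the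
  -- weighted sum is 2^(k+1) - 1, which is at least `x`.
  bit : ℕ → ℕ → ℕ
  bit x i with 2 ^ i ≤? x
  ... | yes _ = 1
  ... | no _ = 0

  bit-1 : ∀ x i → 2 ^ i ≤ x → bit x i ≡ 1
  bit-1 x i le with 2 ^ i ≤? x
  ... | yes _ = refl
  ... | no ≰ = ⊥-elim (≰ le)

  level-∷ : ∀ f s xs i → length (level f (s ∷ xs) i) ≡ bit (f s) i + length (level f xs i)
  level-∷ f s xs i with 2 ^ i ≤? f s
  ... | yes p = cong length (filter-accept (λ s → 2 ^ i ≤? f s) p)
  ... | no ¬p = cong length (filter-reject (λ s → 2 ^ i ≤? f s) ¬p)

  bits-full : ∀ h x → 2 ^ h ≤ x → 2 ^ h ≤ suc (sumBelow h (λ i → 2 ^ i * bit x i))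
  bits-full zero x _ = ≤-refl
  bits-full (suc h) x le = begin
    2 ^ h + (2 ^ h + 0) ≡⟨ cong (2 ^ h +_) (+-identityʳ (2 ^ h)) ⟩
    2 ^ h + 2 ^ h ≤⟨ +-monoˡ-≤ (2 ^ h) (bits-full h x 2^h≤x) ⟩
    suc (sumBelow h (λ i → 2 ^ i * bit x i)) + 2 ^ h ≡⟨ cong (suc (sumBelow h (λ i → 2 ^ i * bit x i)) +_)
      (trans (cong (2 ^ h *_) (bit-1 x h 2^h≤x)) (*-identityʳ (2 ^ h))) ⟨
    suc (sumBelow h (λ i → 2 ^ i * bit x i)) + 2 ^ h * bit x h ∎
    where
    open ≤-Reasoning
    2^h≤x : 2 ^ h ≤ x
    2^h≤x = ≤-trans (m≤m+n (2 ^ h) _) le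

  bits : ∀ h x → x < 2 ^ h → x ≤ sumBelow h (λ i → 2 ^ i * bit x i)
  bits zero x x<1 = s≤s⁻¹ x<1
  bits (suc h) x x< with 2 ^ h ≤? x
  ... | yes le = s≤s⁻¹ (≤-trans x< (begin
    2 ^ h + (2 ^ h + 0) ≤⟨ +-mono-≤ (bits-full h x le) (≤-reflexive (trans (+-identityʳ (2 ^ h)) (sym (*-identityʳ (2 ^ h))))) ⟩
    suc (sumBelow h (λ i → 2 ^ i * bit x i)) + 2 ^ h * 1 ∎))
    where open ≤-Reasoning
  ... | no ≰ = ≤-trans (bits h x (≰⇒> ≰)) (m≤m+n _ _)

dyadic : ∀ f h xs → All (λ s → f s < 2 ^ h) xs →
  sum (map f xs) ≤ sumBelow h (λ i → 2 ^ i * length (level f xs i))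
dyadic f h [] [] = z≤n
dyadic f h (s ∷ xs) (p ∷ ps) = begin
  f s + sum (map f xs) ≤⟨ +-mono-≤ (bits h (f s) p) (dyadic f h xs ps) ⟩
  sumBelow h (λ i → 2 ^ i * bit (f s) i) + sumBelow h (λ i → 2 ^ i * length (level f xs i)) ≡⟨ sumBelow-+ h _ _ ⟨
  sumBelow h (λ i → 2 ^ i * bit (f s) i + 2 ^ i * length (level f xs i)) ≡⟨ sumBelow-cong h (λ i →
    trans (sym (*-distribˡ-+ (2 ^ i) (bit (f s) i) _)) (cong (2 ^ i *_) (sym (level-∷ f s xs i)))) ⟩
  sumBelow h (λ i → 2 ^ i * length (level f (s ∷ xs) i)) ∎
  where open ≤-Reasoning

-- The bound `2 ^ h ≤ 2 * a` makes `h` a lower bound for the logarithm of 2a, as the hypotheses on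
-- `X` require; `a < 2 ^ h` makes `h` a sufficient number of dyadic levels.
log₂ : ∀ a → 0 < a → ∃[ h ] 0 < h × 2 ^ h ≤ 2 * a × a < 2 ^ h
log₂ (suc zero) _ = 1 , z<s , ≤-refl , ≤-refl
log₂ (suc (suc a)) _ with log₂ (suc a) z<s
... | h , 0<h , lo , hi with suc (suc a) <? 2 ^ h
...   | yes p = h , 0<h , ≤-trans lo (*-monoʳ-≤ 2 (n≤1+n (suc a))) , p
...   | no ¬p = suc h , z<s , *-monoʳ-≤ 2 (≮⇒≥ ¬p) , (begin-strict
        suc (suc a) ≤⟨ hi ⟩
        2 ^ h <⟨ m<m+n (2 ^ h) (≤-trans (≤-trans z<s hi) (m≤m+n (2 ^ h) 0)) ⟩
        2 ^ suc h ∎)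
  where open ≤-Reasoning

-- Counting a list by its values.

mults-∷-≤ : ∀ u U {ws} → Unique ws →
  sum (map (λ w → mult w (u ∷ U)) ws) ≤ suc (sum (map (λ w → mult w U) ws))
mults-∷-≤ u U {[]} [] = z≤n
mults-∷-≤ u U {w ∷ ws} (w∉ ∷ uw) with u ≟ w
... | yes refl = +-mono-≤ (≤-reflexive (mult-here u U)) (≤-reflexive (cong sum
      (map-cong-∈ ws λ x∈ → mult-there U (All.lookup w∉ x∈))))
  where
  map-cong-∈ : ∀ xs {f g : ℕ → ℕ} → (∀ {x} → x ∈ xs → f x ≡ g x) → map f xs ≡ map g xs
  map-cong-∈ [] eq = refl
  map-cong-∈ (x ∷ xs) eq = cong₂ _∷_ (eq (here refl)) (map-cong-∈ xs (eq ∘ there))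
... | no u≢w = ≤-trans (+-mono-≤ (≤-reflexive (mult-there U u≢w)) (mults-∷-≤ u U uw)) (≤-reflexive (+-suc (mult w U) _))

mults-≤-length : ∀ U {ws} → Unique ws → sum (map (λ w → mult w U) ws) ≤ length U
mults-≤-length [] {ws} uw = ≤-reflexive (zeros ws)
  where
  zeros : ∀ ws → sum (map (λ w → mult w []) ws) ≡ 0
  zeros [] = refl
  zeros (w ∷ ws) = zeros ws
mults-≤-length (u ∷ U) uw = ≤-trans (mults-∷-≤ u U uw) (s≤s (mults-≤-length U uw))

length-≤-mults : ∀ U {ws} → All (_∈ ws) U → length U ≤ sum (map (λ w → mult w U) ws)
length-≤-mults [] _ = z≤n
length-≤-mults (u ∷ U) (u∈ ∷ U⊆) = ≤-trans (s≤s (length-≤-mults U U⊆)) (bump u∈)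
  where
  mono : ∀ ws → sum (map (λ w → mult w U) ws) ≤ sum (map (λ w → mult w (u ∷ U)) ws)
  mono [] = z≤n
  mono (w ∷ ws) = +-mono-≤ (mult-∷-≤ w u U) (mono ws)
  bump : ∀ {ws} → u ∈ ws → suc (sum (map (λ w → mult w U) ws)) ≤ sum (map (λ w → mult w (u ∷ U)) ws)
  bump {w ∷ ws} (here refl) = +-mono-≤ (≤-reflexive (sym (mult-here u U))) (mono ws)
  bump {w ∷ ws} (there u∈) = ≤-trans (≤-reflexive (sym (+-suc (mult w U) _))) (+-mono-≤ (mult-∷-≤ w u U) (bump u∈))

exhausted-bound : ∀ q U {ws} → Unique ws → All (λ w → q ≤ mult w U) ws → length ws * q ≤ length U
exhausted-bound q U uw all = ≤-trans (go all) (mults-≤-length U uw)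
  where
  go : ∀ {ws} → All (λ w → q ≤ mult w U) ws → length ws * q ≤ sum (map (λ w → mult w U) ws)
  go [] = z≤n
  go (p ∷ ps) = +-mono-≤ p (go ps)

-- Representations as sums of disjoint pairs.

splits? : ∀ s v V → Dec (v ≤ s × s ∸ v ∈ V)
splits? s v V = (v ≤? s) ×-dec (s ∸ v ∈? V)

-- A partner is sought only in the tail, so for a duplicate-free list this counts unordered pairs of
-- distinct elements with sum `s`.
reps : ℕ → List ℕ → ℕ
reps s [] = 0
reps s (v ∷ V) with splits? s v V
... | yes _ = suc (reps s V)
... | no _ = reps s V

-- The last entry has no tail to find a partner in, which saves one. With 0 put in front of a list,
-- counts therefore do not exceed the length of that list.
reps-< : ∀ s v V → reps s (v ∷ V) ≤ length V
reps-< s v [] with splits? s v []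
... | no _ = z≤n
reps-< s v (w ∷ V) with splits? s v (w ∷ V)
... | yes _ = s≤s (reps-< s w V)
... | no _ = m≤n⇒m≤1+n (reps-< s w V)

module _ (S : List ℕ) where

  reps-sum-∷ : ∀ v V → Unique (v ∷ V) → All (λ w → v + w ∈ S) V →
    length V + sum (map (λ s → reps s V) S) ≤ sum (map (λ s → reps s (v ∷ V)) S)
  reps-sum-∷ v V (_ ∷ uV) sums = ≤-trans (+-monoˡ-≤ _ count) (go S)
    where
    count : length V ≤ length (filter (λ s → splits? s v V) S)
    count = ≤-trans (≤-reflexive (sym (length-map (v +_) V)))
      (unique-⊆-length (unique-map-on (v +_) (λ _ _ → +-cancelˡ-≡ v _ _) uV) λ z∈ →
        let w , w∈ , eq = ∈-map⁻ (v +_) z∈ in subst (_∈ filter (λ s → splits? s v V) S) (sym eq)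
          (∈-filter⁺ (λ s → splits? s v V) (All.lookup sums w∈)
            (m≤m+n v w , subst (_∈ V) (sym (m+n∸m≡n v w)) w∈)))
    swap : ∀ a b c → a + (b + c) ≡ b + (a + c)
    swap = solve-∀
    swap′ : ∀ s S → length (filter (λ s → splits? s v V) S) + (reps s V + sum (map (λ s → reps s V) S)) ≡
                    reps s V + (length (filter (λ s → splits? s v V) S) + sum (map (λ s → reps s V) S))
    swap′ s S = swap (length (filter (λ s → splits? s v V) S)) (reps s V) (sum (map (λ s → reps s V) S))
    go : ∀ S → length (filter (λ s → splits? s v V) S) + sum (map (λ s → reps s V) S) ≤
               sum (map (λ s → reps s (v ∷ V)) S)
    go [] = z≤n
    go (s ∷ S) with splits? s v V
    ... | yes p = ≤-trans (≤-reflexive (trans (cong (λ xs → length xs + sum (map (λ s → reps s V) (s ∷ S)))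
                    (filter-accept (λ s → splits? s v V) p)) (cong suc (swap′ s S))))
                    (s≤s (+-monoʳ-≤ (reps s V) (go S)))
    ... | no ¬p = ≤-trans (≤-reflexive (trans (cong (λ xs → length xs + sum (map (λ s → reps s V) (s ∷ S)))
                    (filter-reject (λ s → splits? s v V) ¬p)) (swap′ s S)))
                    (+-monoʳ-≤ (reps s V) (go S))

  -- Double counting: each of the |V|(|V| - 1)/2 pairs has its sum in `S`.
  reps-sum : ∀ V → Unique V → (∀ {v w} → v ∈ V → w ∈ V → v ≢ w → v + w ∈ S) →
    length V * length V ≤ 2 * sum (map (λ s → reps s V) S) + length V
  reps-sum [] _ _ = z≤n
  reps-sum (v ∷ V) u@(v∉ ∷ uV) sums = begin
    suc l * suc l ≡⟨ expand l ⟩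
    l * l + (2 * l + 1) ≤⟨ +-monoˡ-≤ _ (reps-sum V uV (λ p q → sums (there p) (there q))) ⟩
    2 * T + l + (2 * l + 1) ≡⟨ regroup T l ⟩
    2 * (l + T) + suc l ≤⟨ +-monoˡ-≤ (suc l) (*-monoʳ-≤ 2 (reps-sum-∷ v V u
       (All.tabulate λ w∈ → sums (here refl) (there w∈) (All.lookup v∉ w∈)))) ⟩
    2 * sum (map (λ s → reps s (v ∷ V)) S) + suc l ∎
    where
    open ≤-Reasoning
    l = length V
    T = sum (map (λ s → reps s V) S)
    expand : ∀ l → suc l * suc l ≡ l * l + (2 * l + 1)
    expand = solve-∀
    regroup : ∀ T l → 2 * T + l + (2 * l + 1) ≡ 2 * (l + T) + suc l
    regroup = solve-∀

-- The pairs with sum s are disjoint, so each exhausted value spoils at most one of them.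
module _ (q : ℕ) (U : List ℕ) (s : ℕ) where

  FreePair : List ℕ → Set
  FreePair V = ∃₂ λ v w → v ∈ V × w ∈ V × v ≢ w × v + w ≡ s × mult v U < q × mult w U < q

  -- One exhausted member is chosen from each pair. Recording that its partner also lies in `V`
  -- shows that the choice for a new pair differs from all earlier ones.
  Spoiled : List ℕ → Set
  Spoiled V = ∃[ ws ] Unique ws × length ws ≡ reps s V × All (λ w → q ≤ mult w U) ws ×
    All (λ w → w ∈ V × w ≤ s × s ∸ w ∈ V) ws

  free-pair? : ∀ V → Unique V → FreePair V ⊎ Spoiled V
  free-pair? [] _ = inj₂ ([] , [] , refl , [] , [])
  free-pair? (v ∷ V) (v∉ ∷ uV) with free-pair? V uV
  ... | inj₁ (x , y , x∈ , y∈ , rest) = inj₁ (x , y , there x∈ , there y∈ , rest)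
  ... | inj₂ (ws , uw , len , ex , sub) with splits? s v V
  ...   | no _ = inj₂ (ws , uw , len , ex , All.map (λ (p , le , r) → there p , le , there r) sub)
  ...   | yes (v≤s , w∈) with mult v U <? q | mult (s ∸ v) U <? q
  ...     | yes p | yes r = inj₁ (v , s ∸ v , here refl , there w∈ , All.lookup v∉ w∈ , m+[n∸m]≡n v≤s , p , r)
  ...     | no ¬p | _ = inj₂ (v ∷ ws ,
            All.tabulate (λ x∈ v≡x → All.lookup v∉ (subst (_∈ V) (sym v≡x) (proj₁ (All.lookup sub x∈))) refl) ∷ uw ,
            cong suc len , ≮⇒≥ ¬p ∷ ex , (here refl , v≤s , there w∈) ∷ All.map (λ (p , le , r) → there p , le , there r) sub)
  ...     | yes _ | no ¬r = inj₂ (s ∸ v ∷ ws ,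
            All.tabulate (λ x∈ w≡x → let _ , _ , v∈ = All.lookup sub x∈ in
              All.lookup v∉ (subst (_∈ V) (trans (cong (s ∸_) (sym w≡x)) (m∸[m∸n]≡n v≤s)) v∈) refl) ∷ uw ,
            cong suc len , ≮⇒≥ ¬r ∷ ex ,
            (there w∈ , m∸n≤m s v , here (m∸[m∸n]≡n v≤s)) ∷ All.map (λ (p , le , r) → there p , le , there r) sub)

  -- If all pairs were spoiled, `U` would hold `q` copies of each of at least `t` distinct values.
  free-pair : ∀ t V → Unique V → t ≤ reps s V → length U < t * q → FreePair V
  free-pair t V uV t≤ U< with free-pair? V uV
  ... | inj₁ p = p
  ... | inj₂ (ws , uw , len , ex , _) = ⊥-elim (<⇒≱ U< (≤-trans (*-monoˡ-≤ q (≤-trans t≤ (≤-reflexive (sym len))))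
        (exhausted-bound q U uw ex)))

-- The elements of `bs` are realized one after another by pairs that are free relative to `Y ++ R`.
-- Counting `R` among the used elements reserves it for adjusting residues.
realize : ∀ A R q t V → Unique V → (∀ {v} → v ∈ V → 0 < v → q ≤ mult v A) →
  ∀ bs → All (λ b → t ≤ reps b V) bs → 2 * length bs + length R ≤ t * q →
  ∃[ Y ] sum Y ≡ sum bs × length Y ≡ 2 * length bs × (∀ v → 0 < v → mult v Y ≤ mult v A ∸ mult v R)
realize A R q t V uV copies [] [] le = [] , refl , refl , λ _ _ → z≤n
realize A R q t V uV copies (b ∷ bs) (p ∷ ps) le =
  let Y , sumY , lenY , room = realize A R q t V uV copies bs ps le′
      v , w , v∈ , w∈ , v≢w , v+w , v< , w< = free-pair q (Y ++ R) b t V uV p (short Y lenY)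
  in v ∷ w ∷ Y , trans (sym (+-assoc v w (sum Y))) (cong₂ _+_ v+w sumY) ,
     trans (cong (λ k → suc (suc k)) lenY) (sym (*-suc 2 (length bs))) ,
     λ x x>0 → fits Y v w v≢w (copies v∈) (copies w∈) v< w< x x>0 (room x x>0)
  where
  open ≤-Reasoning
  step : 2 + (2 * length bs + length R) ≤ t * q
  step = begin
    2 + (2 * length bs + length R) ≡⟨ +-assoc 2 (2 * length bs) (length R) ⟨
    2 + 2 * length bs + length R ≡⟨ cong (_+ length R) (*-suc 2 (length bs)) ⟨
    2 * suc (length bs) + length R ≤⟨ le ⟩
    t * q ∎
  le′ : 2 * length bs + length R ≤ t * q
  le′ = ≤-trans (m≤n+m _ 2) step
  short : ∀ Y → length Y ≡ 2 * length bs → length (Y ++ R) < t * q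
  short Y lenY = begin-strict
    length (Y ++ R) ≡⟨ length-++ Y ⟩
    length Y + length R ≡⟨ cong (_+ length R) lenY ⟩
    2 * length bs + length R <⟨ m<n+m _ {2} z<s ⟩
    2 + (2 * length bs + length R) ≤⟨ step ⟩
    t * q ∎
  fits : ∀ Y v w → v ≢ w → (0 < v → q ≤ mult v A) → (0 < w → q ≤ mult w A) →
    mult v (Y ++ R) < q → mult w (Y ++ R) < q →
    ∀ x → 0 < x → mult x Y ≤ mult x A ∸ mult x R → mult x (v ∷ w ∷ Y) ≤ mult x A ∸ mult x R
  fits Y v w v≢w cv cw v< w< x x>0 old with v ≟ x | w ≟ x
  ... | yes refl | yes refl = ⊥-elim (v≢w refl)
  ... | yes refl | no w≢x = m+n≤o⇒m≤o∸n (mult v (v ∷ w ∷ Y)) (begin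
    mult v (v ∷ w ∷ Y) + mult v R ≡⟨ cong (_+ mult v R) (trans (mult-here v (w ∷ Y)) (cong suc (mult-there Y w≢x))) ⟩
    suc (mult v Y) + mult v R ≡⟨ cong suc (mult-++ v Y R) ⟨
    suc (mult v (Y ++ R)) ≤⟨ v< ⟩
    q ≤⟨ cv x>0 ⟩
    mult v A ∎)
  ... | no v≢x | yes refl = m+n≤o⇒m≤o∸n (mult w (v ∷ w ∷ Y)) (begin
    mult w (v ∷ w ∷ Y) + mult w R ≡⟨ cong (_+ mult w R) (trans (mult-there (w ∷ Y) v≢x) (mult-here w Y)) ⟩
    suc (mult w Y) + mult w R ≡⟨ cong suc (mult-++ w Y R) ⟨
    suc (mult w (Y ++ R)) ≤⟨ w< ⟩
    q ≤⟨ cw x>0 ⟩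
    mult w A ∎)
  ... | no v≢x | no w≢x = ≤-trans (≤-reflexive (trans (mult-there (w ∷ Y) v≢x) (mult-there Y w≢x))) old

-- The light half, popular values and popular sums.

split-↭ : ∀ {p} {P : Pred ℕ p} (P? : Decidable P) xs → xs ↭ filter P? xs ++ filter (¬? ∘ P?) xs
split-↭ P? [] = ↭-refl
split-↭ P? (x ∷ xs) with P? x
... | yes _ = prep x (split-↭ P? xs)
... | no _ = ↭-trans (prep x (split-↭ P? xs)) (↭-sym (shift x (filter P? xs) _))

halve : ∀ (xs : List ℕ) → ∃₂ λ ys zs → xs ↭ ys ++ zs × length xs ≤ 2 * length ys + 1 × length xs ≤ 2 * length zs + 1
halve [] = [] , [] , ↭-refl , z≤n , z≤n
halve (x ∷ []) = x ∷ [] , [] , ↭-refl , s≤s z≤n , ≤-refl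
halve (x ∷ y ∷ xs) with ys , zs , p , l₁ , l₂ ← halve xs =
  x ∷ ys , y ∷ zs , prep x (↭-trans (prep y p) (↭-sym (shift y ys zs))) , grow (length ys) l₁ , grow (length zs) l₂
  where
  eq : ∀ k → 2 + (2 * k + 1) ≡ 2 * suc k + 1
  eq = solve-∀
  grow : ∀ k → length xs ≤ 2 * k + 1 → 2 + length xs ≤ 2 * suc k + 1
  grow k le = ≤-trans (+-monoʳ-≤ 2 le) (≤-reflexive (eq k))

-- Choosing the lighter half leaves at least half of the total sum for the greedy extension.
lighter-half : ∀ xs → ∃₂ λ ys zs → xs ↭ ys ++ zs × length xs ≤ 2 * length ys + 1 × 2 * sum ys ≤ sum xs
lighter-half xs with ys , zs , p , l₁ , l₂ ← halve xs with ≤-total (sum ys) (sum zs)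
... | inj₁ le = ys , zs , p , l₁ , (begin
  sum ys + (sum ys + 0) ≤⟨ +-monoʳ-≤ (sum ys) (≤-trans (≤-reflexive (+-identityʳ _)) le) ⟩
  sum ys + sum zs ≡⟨ sum-++ ys zs ⟨
  sum (ys ++ zs) ≡⟨ sum-↭ p ⟨
  sum xs ∎)
  where open ≤-Reasoning
... | inj₂ le = zs , ys , ↭-trans p (++-comm ys zs) , l₂ , (begin
  sum zs + (sum zs + 0) ≤⟨ +-mono-≤ le (≤-reflexive (+-identityʳ _)) ⟩
  sum ys + sum zs ≡⟨ sum-++ ys zs ⟨
  sum (ys ++ zs) ≡⟨ sum-↭ p ⟨
  sum xs ∎)
  where open ≤-Reasoning

-- Markov's inequality: at most half of the elements exceed twice the mean.
small-elements : ∀ X → 0 < sum X →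
  length X ≤ 2 * length (filter (λ x → x * length X ≤? 2 * sum X) X)
small-elements X σ>0 = +-cancelʳ-≤ n n (2 * length A) (begin
  n + n ≡⟨ cong (n +_) (+-identityʳ n) ⟨
  2 * n ≡⟨ cong (2 *_) (length-filter-split small? X) ⟨
  2 * (length A + length L) ≡⟨ *-distribˡ-+ 2 (length A) (length L) ⟩
  2 * length A + 2 * length L ≤⟨ +-monoʳ-≤ (2 * length A) few ⟩
  2 * length A + n ∎)
  where
  open ≤-Reasoning
  n = length X
  small? : Decidable (λ x → x * n ≤ 2 * sum X)
  small? x = x * n ≤? 2 * sum X
  A = filter small? X
  L = filter (¬? ∘ small?) X
  heavy : ∀ xs → All (λ x → ¬ x * n ≤ 2 * sum X) xs → length xs * (2 * sum X) ≤ sum xs * n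
  heavy [] [] = z≤n
  heavy (x ∷ xs) (p ∷ ps) = ≤-trans (+-mono-≤ (<⇒≤ (≰⇒> p)) (heavy xs ps)) (≤-reflexive (sym (*-distribʳ-+ n x (sum xs))))
  instance
    σ≢0 : NonZero (sum X)
    σ≢0 = >-nonZero σ>0
  comm : ∀ l s → 2 * l * s ≡ l * (2 * s)
  comm = solve-∀
  few : 2 * length L ≤ n
  few = *-cancelʳ-≤ (2 * length L) n (sum X) (begin
    2 * length L * sum X ≡⟨ comm (length L) (sum X) ⟩
    length L * (2 * sum X) ≤⟨ heavy L (All.tabulate λ x∈ → proj₂ (∈-filter⁻ (¬? ∘ small?) {xs = X} x∈)) ⟩
    sum L * n ≤⟨ *-monoˡ-≤ n (≤-trans (m≤n+m (sum L) (sum A)) (≤-reflexive (trans (sym (sum-++ A L)) (sym (sum-↭ (split-↭ small? X)))))) ⟩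
    sum X * n ≡⟨ *-comm (sum X) n ⟩
    n * sum X ∎)

mult>0⇒∈ : ∀ {v xs} → 0 < mult v xs → v ∈ xs
mult>0⇒∈ {v} {xs} p with v ∈? xs
... | yes v∈ = v∈
... | no v∉ = ⊥-elim (<⇒≢ p (sym (mult-∉ v∉)))

mult≤μ : ∀ v X → mult v X ≤ μ X
mult≤μ v X with v ∈? X
... | yes v∈ = ≤maxElem (∈-map⁺ (λ x → mult x X) v∈)
... | no v∉ = ≤-trans (≤-reflexive (mult-∉ v∉)) z≤n

-- The multiplicities in `A` add up to at least |A|, so one of the `ℓ` dyadic levels carries a 1/ℓ
-- share; `q` is its power of two.
popular-values : ∀ A ℓ → 0 < ℓ → (∀ v → mult v A < 2 ^ ℓ) →
  ∃₂ λ q V → Unique V × (∀ {v} → v ∈ V → v ∈ A × q ≤ mult v A) × length A ≤ ℓ * (q * length V)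
popular-values A ℓ ℓ>0 bound = select (sumBelow-pigeonhole ℓ (λ i → ℓ * (2 ^ i * length (V i))) (λ _ → length A) ℓ>0 (begin
  sumBelow ℓ (λ _ → length A) ≡⟨ sumBelow-const ℓ (length A) ⟩
  ℓ * length A ≤⟨ *-monoʳ-≤ ℓ (≤-trans (length-≤-mults A (All.tabulate (λ a∈ → ∈-upTo⁺ (s≤s (≤maxElem a∈)))))
                    (dyadic f ℓ values (All.tabulate (λ {v} _ → bound v)))) ⟩
  ℓ * sumBelow ℓ (λ i → 2 ^ i * length (V i)) ≡⟨ sumBelow-* ℓ ℓ _ ⟨
  sumBelow ℓ (λ i → ℓ * (2 ^ i * length (V i))) ∎))
  where
  open ≤-Reasoning
  f : ℕ → ℕ
  f v = mult v A
  values : List ℕ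
  values = upTo (suc (maxElem A))
  V : ℕ → List ℕ
  V = level f values
  select : _ → ∃₂ λ q V → Unique V × (∀ {v} → v ∈ V → v ∈ A × q ≤ mult v A) × length A ≤ ℓ * (q * length V)
  select (i , _ , le) = 2 ^ i , V i , Unique.filter⁺ (λ s → 2 ^ i ≤? f s) (Unique.upTo⁺ _) ,
    (λ v∈ → let p = proj₂ (∈-filter⁻ (λ s → 2 ^ i ≤? f s) {xs = values} v∈) in
      mult>0⇒∈ (≤-trans (m^n>0 2 i) p) , p) , le

-- Both conclusions must hold at the same level, so the pigeonhole compares `F` with the two-term
-- `G`. Each term of `G` adds up to at most 2ha², and `F` to at least 4ha². At the level found, the
-- first term gives the bound on a² and the second the bound on a.
popular-sums : ∀ V M h → Unique V → (∀ {v} → v ∈ V → 0 < v × v ≤ M) →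
  0 < h → 2 ^ h ≤ 2 * length V → length V < 2 ^ h →
  ∃₂ λ t B → Unique B × (∀ {b} → b ∈ B → 0 < b × b ≤ 2 * M × t ≤ reps b (0 ∷ V)) ×
    length V * length V ≤ 4 * h * (t * length B) × length V ≤ 8 * length B
popular-sums V M h uV bV h>0 2^h≤ a< = select (sumBelow-pigeonhole h F G h>0 (begin
  sumBelow h G ≡⟨ sumBelow-+ h (λ _ → 2 * (a * a)) (λ i → h * a * 2 ^ i) ⟩
  sumBelow h (λ _ → 2 * (a * a)) + sumBelow h (λ i → h * a * 2 ^ i) ≡⟨ cong₂ _+_ (sumBelow-const h _) (sumBelow-* h (h * a) (2 ^_)) ⟩
  h * (2 * (a * a)) + h * a * sumBelow h (2 ^_) ≤⟨ +-monoʳ-≤ _ (*-monoʳ-≤ (h * a)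
     (≤-trans (n≤1+n _) (≤-trans (≤-reflexive (sumBelow-2^ h)) 2^h≤))) ⟩
  h * (2 * (a * a)) + h * a * (2 * a) ≡⟨ ring₁ h a ⟩
  4 * h * (a * a) ≤⟨ *-monoʳ-≤ (4 * h) pairs ⟩
  4 * h * (2 * sum (map f sums)) ≤⟨ *-monoʳ-≤ (4 * h) (*-monoʳ-≤ 2 (dyadic f h sums
     (All.tabulate λ {s} _ → ≤-<-trans (reps-< s 0 V) a<))) ⟩
  4 * h * (2 * sumBelow h (λ i → 2 ^ i * length (B i))) ≡⟨ ring₂ h _ ⟩
  8 * h * sumBelow h (λ i → 2 ^ i * length (B i)) ≡⟨ sumBelow-* h (8 * h) _ ⟨
  sumBelow h F ∎))
  where
  open ≤-Reasoning
  a = length V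
  f : ℕ → ℕ
  f s = reps s (0 ∷ V)
  sums : List ℕ
  sums = map suc (upTo (2 * M))
  B : ℕ → List ℕ
  B = level f sums
  F G : ℕ → ℕ
  F i = 8 * h * (2 ^ i * length (B i))
  G i = 2 * (a * a) + h * a * 2 ^ i
  ring₁ : ∀ h a → h * (2 * (a * a)) + h * a * (2 * a) ≡ 4 * h * (a * a)
  ring₁ = solve-∀
  ring₂ : ∀ h s → 4 * h * (2 * s) ≡ 8 * h * s
  ring₂ = solve-∀
  ring₃ : ∀ h t b → 8 * h * (t * b) ≡ 2 * (4 * h * (t * b))
  ring₃ = solve-∀
  ring₄ : ∀ h t a → h * a * t ≡ a * (h * t)
  ring₄ = solve-∀
  ring₅ : ∀ h t b → 8 * h * (t * b) ≡ 8 * b * (h * t)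
  ring₅ = solve-∀
  ring₆ : ∀ a → suc a * suc a ≡ a * a + a + suc a
  ring₆ = solve-∀
  ∈sums : ∀ {s} → 0 < s → s ≤ 2 * M → s ∈ sums
  ∈sums {suc s} _ le = ∈-map⁺ suc (∈-upTo⁺ le)
  bV₀ : ∀ {v} → v ∈ 0 ∷ V → v ≤ M
  bV₀ (here refl) = z≤n
  bV₀ (there v∈) = proj₂ (bV v∈)
  pos : ∀ {v w} → v ∈ 0 ∷ V → w ∈ 0 ∷ V → v ≢ w → 0 < v + w
  pos {suc v} _ _ _ = z<s
  pos {zero} {suc w} _ _ _ = z<s
  pos {zero} {zero} _ _ v≢w = ⊥-elim (v≢w refl)
  -- With 0 adjoined there are a(a + 1)/2 pairs, so a full a² remains, even for a = 1.
  pairs : a * a ≤ 2 * sum (map f sums)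
  pairs = ≤-trans (m≤m+n (a * a) a) (+-cancelʳ-≤ (suc a) _ _ (begin
    a * a + a + suc a ≡⟨ ring₆ a ⟨
    suc a * suc a ≤⟨ reps-sum sums (0 ∷ V) (All.tabulate (λ v∈ → <⇒≢ (proj₁ (bV v∈))) ∷ uV)
      (λ v∈ w∈ v≢w → ∈sums (pos v∈ w∈ v≢w) (≤-trans (+-mono-≤ (bV₀ v∈) (bV₀ w∈)) (≤-reflexive (cong (M +_) (sym (+-identityʳ M)))))) ⟩
    2 * sum (map f sums) + suc a ∎))
  select : _ → ∃₂ λ t B → Unique B × (∀ {b} → b ∈ B → 0 < b × b ≤ 2 * M × t ≤ reps b (0 ∷ V)) ×
    a * a ≤ 4 * h * (t * length B) × a ≤ 8 * length B
  select (i , _ , le) = 2 ^ i , B i , Unique.filter⁺ (λ s → 2 ^ i ≤? f s) (Unique.map⁺ suc-injective (Unique.upTo⁺ (2 * M))) ,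
    (λ b∈ → let b∈s , p = ∈-filter⁻ (λ s → 2 ^ i ≤? f s) {xs = sums} b∈
                c , c∈ , eq = ∈-map⁻ suc b∈s
            in subst (0 <_) (sym eq) z<s , subst (_≤ 2 * M) (sym eq) (∈-upTo⁻ c∈) , p) ,
    *-cancelˡ-≤ 2 (≤-trans (≤-trans (m≤m+n (2 * (a * a)) _) le) (≤-reflexive (ring₃ h (2 ^ i) (length (B i))))) ,
    *-cancelʳ-≤ a _ (h * 2 ^ i) {{m*n≢0 h (2 ^ i) {{>-nonZero h>0}} {{>-nonZero (m^n>0 2 i)}}}} (begin
      a * (h * 2 ^ i) ≡⟨ ring₄ h (2 ^ i) a ⟨
      h * a * 2 ^ i ≤⟨ m≤n+m _ (2 * (a * a)) ⟩
      G i ≤⟨ le ⟩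
      F i ≡⟨ ring₅ h (2 ^ i) (length (B i)) ⟩
      8 * length (B i) * (h * 2 ^ i) ∎)

-- Assembling a subset sum.

-- All `r` copies are withheld from both parts, since it is not known which part supplies them. If
-- `r ≤ a` they fit beside `y`; otherwise `y` is 0 and `r + (o ∸ r)` is the larger of `r` and `o`.
disjoint-fit : ∀ {y r₁ o₁ a r o} → y ≤ a ∸ r → r₁ ≤ r → o₁ ≤ o ∸ r → r ≤ a + o → y + (r₁ + o₁) ≤ a + o
disjoint-fit {y} {r₁} {o₁} {a} {r} {o} y≤ r₁≤ o₁≤ r≤ with ≤-total r a
... | inj₁ r≤a = begin
  y + (r₁ + o₁) ≡⟨ +-assoc y r₁ o₁ ⟨
  y + r₁ + o₁ ≤⟨ +-mono-≤ (+-mono-≤ y≤ r₁≤) (≤-trans o₁≤ (m∸n≤m o r)) ⟩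
  a ∸ r + r + o ≡⟨ cong (_+ o) (m∸n+n≡m r≤a) ⟩
  a + o ∎
  where open ≤-Reasoning
... | inj₂ a≤r = begin
  y + (r₁ + o₁) ≤⟨ +-mono-≤ (≤-trans y≤ (≤-reflexive (m≤n⇒m∸n≡0 a≤r))) (+-mono-≤ r₁≤ o₁≤) ⟩
  r + (o ∸ r) ≤⟨ total ⟩
  a + o ∎
  where
  open ≤-Reasoning
  total : r + (o ∸ r) ≤ a + o
  total with ≤-total r o
  ... | inj₁ r≤o = ≤-trans (≤-reflexive (m+[n∸m]≡n r≤o)) (m≤n+m o a)
  ... | inj₂ o≤r = ≤-trans (≤-reflexive (trans (cong (r +_) (m≤n⇒m∸n≡0 o≤r)) (+-identityʳ r))) r≤

sum-⊆ : ∀ {xs ys : List ℕ} → xs ⊆ ys → sum xs ≤ sum ys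
sum-⊆ {xs} p with _ , _ , eq ← complement p = subst (sum xs ≤_) eq (m≤m+n _ _)

module Assembly (X A O : List ℕ) (m : ℕ) (X↭ : X ↭ A ++ O) (X≤m : All (_≤ m) X) (m>0 : 0 < m)
  (light : 2 * sum A ≤ sum X)
  (q t : ℕ) (V B : List ℕ) (uV : Unique V) (copies : ∀ {v} → v ∈ V → 0 < v → q ≤ mult v A)
  (popular : ∀ {b} → b ∈ B → t ≤ reps b V) (N d k₀ : ℕ) (d>0 : 0 < d)
  (represent : ∀ z → d ∣ z → k₀ * N ≤ z → ∃[ bs ] All (_∈ B) bs × sum bs ≡ z × length bs * N ≤ k₀ * N + z)
  (spread : ∀ e → 1 < e → d ≤ length (notDivBy e X))
  (capacity : ∀ k → k * N ≤ k₀ * N + (k₀ * N + d * m + m) → 2 * k + d ≤ t * q) where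

  private
    cover : ∀ d′ → d ≡ d′ → 0 < d′ → ∃₂ λ R Z → X ↭ R ++ Z × length R < d × sum R ≤ d * m ×
      (∀ z → ∃[ R₁ ] R₁ ⊆ R × d ∣ z ∸ sum R₁)
    cover (suc n) refl _ =
      let R , Z , X↭RZ , R<d , hit = ResidueCover.residue-cover n X spread in
      R , Z , X↭RZ , R<d ,
      ≤-trans (sum-≤ {R} (All.tabulate λ x∈ → All.lookup X≤m (∈-resp-↭ (↭-sym X↭RZ) (∈-++⁺ˡ x∈))))
        (*-monoˡ-≤ m (<⇒≤ R<d)) , λ z → let R₁ , R₁⊆ , eq = hit z in R₁ , R₁⊆ , %≡⇒∣∸ {z} {sum R₁} (suc n) (sym eq)

  -- The choices are made from the outside in: `O₁` brings `y` down to some `z` in the window, `R₁`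
  -- makes the rest divisible by `d`, and this rest is a sum over `B`, realized inside `A` away from
  -- `R`.
  assemble : ∀ y → k₀ * N + d * m ≤ y → 2 * y ≤ sum X → InSubsetSums y X
  assemble y u≤y 2y≤ with cover d refl d>0
  ... | R , Z , X↭RZ , R<d , R≤ , hit with difference O R
  ...   | O′ , multO′ , sumO′ , O′⊆O with greedy O′ O′≤m (k₀ * N + d * m) y u≤y y<
    where
    open ≤-Reasoning
    O⊆X : ∀ {x} → x ∈ O → x ∈ X
    O⊆X x∈ = ∈-resp-↭ (↭-sym X↭) (∈-++⁺ʳ A x∈)
    O′≤m : All (_≤ m) O′
    O′≤m = All.tabulate λ x∈ → All.lookup X≤m (O⊆X (O′⊆O x∈))
    y≤O : y ≤ sum O
    y≤O = *-cancelˡ-≤ 2 (+-cancelˡ-≤ (2 * sum A) _ _ (begin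
      2 * sum A + 2 * y ≤⟨ +-mono-≤ light 2y≤ ⟩
      sum X + sum X ≡⟨ cong (sum X +_) (+-identityʳ (sum X)) ⟨
      2 * sum X ≡⟨ cong (2 *_) (trans (sum-↭ X↭) (sum-++ A O)) ⟩
      2 * (sum A + sum O) ≡⟨ *-distribˡ-+ 2 (sum A) (sum O) ⟩
      2 * sum A + 2 * sum O ∎))
    -- Removing `R` from `O` costs at most `d * m`, which the start of the window makes up for.
    y< : y < k₀ * N + d * m + m + sum O′
    y< = begin-strict
      y ≤⟨ y≤O ⟩
      sum O ≤⟨ sumO′ ⟩
      sum O′ + sum R ≤⟨ +-monoʳ-≤ (sum O′) (≤-trans R≤ (m≤n+m (d * m) (k₀ * N))) ⟩
      sum O′ + (k₀ * N + d * m) ≡⟨ +-comm (sum O′) _ ⟩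
      k₀ * N + d * m + sum O′ <⟨ +-monoˡ-< (sum O′) (m<m+n (k₀ * N + d * m) m>0) ⟩
      k₀ * N + d * m + m + sum O′ ∎
  ...     | O₁ , z , O₁⊆ , u≤z , z< , z+O₁ with hit z
  ...       | R₁ , R₁⊆ , d∣ with represent (z ∸ sum R₁) d∣ k₀N≤
    where
    -- The summand `d * m` of the window's start pays for subtracting `R₁`.
    k₀N≤ : k₀ * N ≤ z ∸ sum R₁
    k₀N≤ = m+n≤o⇒m≤o∸n (k₀ * N) (≤-trans (+-monoʳ-≤ (k₀ * N) (≤-trans (sum-⊆ R₁⊆) R≤)) u≤z)
  ...         | bs , bs⊆ , sum-bs , len-bs with realize A R q t V uV copies bs (All.map popular bs⊆) enough
    where
    enough : 2 * length bs + length R ≤ t * q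
    enough = ≤-trans (+-monoʳ-≤ (2 * length bs) (<⇒≤ R<d)) (capacity (length bs)
      (≤-trans len-bs (+-monoʳ-≤ (k₀ * N) (≤-trans (m∸n≤m z (sum R₁)) (<⇒≤ z<)))))
  ...           | Y , sumY , _ , room = subst (λ s → InSubsetSums s X) total (embed X (Y ++ (R₁ ++ O₁)) fits)
    where
    open ≤-Reasoning
    R₁≤z : sum R₁ ≤ z
    R₁≤z = begin
      sum R₁ ≤⟨ sum-⊆ R₁⊆ ⟩
      sum R ≤⟨ R≤ ⟩
      d * m ≤⟨ m≤n+m (d * m) (k₀ * N) ⟩
      k₀ * N + d * m ≤⟨ u≤z ⟩
      z ∎
    total : sum (Y ++ (R₁ ++ O₁)) ≡ y
    total = begin-equality
      sum (Y ++ (R₁ ++ O₁)) ≡⟨ trans (sum-++ Y _) (cong (sum Y +_) (sum-++ R₁ O₁)) ⟩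
      sum Y + (sum R₁ + sum O₁) ≡⟨ +-assoc (sum Y) _ _ ⟨
      sum Y + sum R₁ + sum O₁ ≡⟨ cong (λ s → s + sum R₁ + sum O₁) (trans sumY sum-bs) ⟩
      z ∸ sum R₁ + sum R₁ + sum O₁ ≡⟨ cong (_+ sum O₁) (m∸n+n≡m R₁≤z) ⟩
      z + sum O₁ ≡⟨ z+O₁ ⟩
      y ∎
    mX : ∀ v → mult v X ≡ mult v A + mult v O
    mX v = trans (mult-↭ v X↭) (mult-++ v A O)
    fits : ∀ v → 0 < v → mult v (Y ++ (R₁ ++ O₁)) ≤ mult v X
    fits v v>0 = begin
      mult v (Y ++ (R₁ ++ O₁)) ≡⟨ trans (mult-++ v Y _) (cong (mult v Y +_) (mult-++ v R₁ O₁)) ⟩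
      mult v Y + (mult v R₁ + mult v O₁) ≤⟨ disjoint-fit (room v v>0) (mult-mono v R₁⊆)
        (≤-trans (mult-mono v O₁⊆) (≤-reflexive (multO′ v)))
        (≤-trans (m≤m+n (mult v R) (mult v Z)) (≤-reflexive (trans (sym (mult-++ v R Z)) (trans (sym (mult-↭ v X↭RZ)) (mX v))))) ⟩
      mult v A + mult v O ≡⟨ mX v ⟨
      mult v X ∎

-- Numerical estimates.

module Bounds (n σ m μ ℓ q a h t β N M d k₀ : ℕ)
  (dense : 1699200 * h * (ℓ * ℓ) * μ * m ≤ n * n)
  (n≤ : n ≤ 6 * (ℓ * (q * a))) (q≤μ : q ≤ μ) (a≤ : a ≤ 8 * β) (a²≤ : a * a ≤ 4 * h * (t * β))
  (N≤ : N ≤ 2 * M) (M≤m : M ≤ m) (Mn≤ : M * n ≤ 2 * σ)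
  (dβ≤N : d * β ≤ N) (β≤N : β ≤ N) (k₀β≤ : k₀ * β ≤ 3 * N)
  (ℓ>0 : 0 < ℓ) (q>0 : 0 < q) (h>0 : 0 < h) (β>0 : 0 < β) where

  open ≤-Reasoning

  private
    N≤2m : N ≤ 2 * m
    N≤2m = ≤-trans N≤ (*-monoʳ-≤ 2 M≤m)

    n≤β : n ≤ 48 * (ℓ * q) * β
    n≤β = begin
      n ≤⟨ n≤ ⟩
      6 * (ℓ * (q * a)) ≤⟨ *-monoʳ-≤ 6 (*-monoʳ-≤ ℓ (*-monoʳ-≤ q a≤)) ⟩
      6 * (ℓ * (q * (8 * β))) ≡⟨ ring ℓ q β ⟩
      48 * (ℓ * q) * β ∎
      where
      ring : ∀ ℓ q β → 6 * (ℓ * (q * (8 * β))) ≡ 48 * (ℓ * q) * β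
      ring = solve-∀

    Nn≤ : N * n ≤ 4 * σ
    Nn≤ = begin
      N * n ≤⟨ *-monoˡ-≤ n N≤ ⟩
      2 * M * n ≡⟨ *-assoc 2 M n ⟩
      2 * (M * n) ≤⟨ *-monoʳ-≤ 2 Mn≤ ⟩
      2 * (2 * σ) ≡⟨ *-assoc 2 2 σ ⟨
      4 * σ ∎

    -- One factor `n` is traded for `β`, so that `d * β ≤ N` applies, and the other is absorbed by
    -- `N * n ≤ 4 * σ`; 192 is 48 times 4.
    dnn≤ : d * (n * n) ≤ 192 * (ℓ * q * σ)
    dnn≤ = begin
      d * (n * n) ≤⟨ *-monoʳ-≤ d (*-monoʳ-≤ n n≤β) ⟩
      d * (n * (48 * (ℓ * q) * β)) ≡⟨ ring d n (ℓ * q) β ⟩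
      48 * (ℓ * q) * (d * β * n) ≤⟨ *-monoʳ-≤ (48 * (ℓ * q)) (≤-trans (*-monoˡ-≤ n dβ≤N) Nn≤) ⟩
      48 * (ℓ * q) * (4 * σ) ≡⟨ ring′ (ℓ * q) σ ⟩
      192 * (ℓ * q * σ) ∎
      where
      ring : ∀ d n c β → d * (n * (48 * c * β)) ≡ 48 * c * (d * β * n)
      ring = solve-∀
      ring′ : ∀ c σ → 48 * c * (4 * σ) ≡ 192 * (c * σ)
      ring′ = solve-∀

    ℓqσ≤ : ℓ * q * σ ≤ ℓ * μ * σ
    ℓqσ≤ = *-monoˡ-≤ σ (*-monoʳ-≤ ℓ q≤μ)

    assoc₃ : ∀ c x y z → c * (x * y * z) ≡ c * x * y * z
    assoc₃ = solve-∀

    assoc₄ : ∀ c x y z w → c * (x * y * z * w) ≡ c * x * y * w * z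
    assoc₄ = solve-∀

  -- Consequently any number above 1 that leaves fewer than `d` elements undivided would be an
  -- almost divisor.
  divisor-bound : d * (n * n) ≤ 42480 * ℓ * μ * σ
  divisor-bound = begin
    d * (n * n) ≤⟨ dnn≤ ⟩
    192 * (ℓ * q * σ) ≤⟨ *-mono-≤ (≤ᵇ⇒≤ 192 42480 tt) ℓqσ≤ ⟩
    42480 * (ℓ * μ * σ) ≡⟨ assoc₃ 42480 ℓ μ σ ⟩
    42480 * ℓ * μ * σ ∎

  -- This places the start of the window below λ. The term with `k₀` contributes 48 · 3 · 2 · 4 =
  -- 1152 and the term with `d` another 192.
  start-bound : (k₀ * N + d * m) * (n * n) ≤ 169920 * ℓ * μ * m * σ
  start-bound = begin
    (k₀ * N + d * m) * (n * n) ≡⟨ ring₁ k₀ N d m n ⟩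
    k₀ * N * n * n + d * (n * n) * m ≤⟨ +-mono-≤ (*-monoʳ-≤ (k₀ * N * n) n≤β) (*-monoˡ-≤ m dnn≤) ⟩
    k₀ * N * n * (48 * (ℓ * q) * β) + 192 * (ℓ * q * σ) * m ≡⟨ cong (_+ 192 * (ℓ * q * σ) * m) (ring₂ k₀ N n (ℓ * q) β) ⟩
    48 * (ℓ * q) * (k₀ * β * (N * n)) + 192 * (ℓ * q * σ) * m
      ≤⟨ +-monoˡ-≤ _ (*-monoʳ-≤ (48 * (ℓ * q)) (*-mono-≤ (≤-trans k₀β≤ (*-monoʳ-≤ 3 N≤2m)) Nn≤)) ⟩
    48 * (ℓ * q) * (3 * (2 * m) * (4 * σ)) + 192 * (ℓ * q * σ) * m ≡⟨ ring₃ (ℓ * q) m σ ⟩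
    1344 * (ℓ * q * σ * m) ≤⟨ *-mono-≤ (≤ᵇ⇒≤ 1344 169920 tt) (*-monoˡ-≤ m ℓqσ≤) ⟩
    169920 * (ℓ * μ * σ * m) ≡⟨ assoc₄ 169920 ℓ μ σ m ⟩
    169920 * ℓ * μ * m * σ ∎
    where
    ring₁ : ∀ k N d m n → (k * N + d * m) * (n * n) ≡ k * N * n * n + d * (n * n) * m
    ring₁ = solve-∀
    ring₂ : ∀ k N n c β → k * N * n * (48 * c * β) ≡ 48 * c * (k * β * (N * n))
    ring₂ = solve-∀
    ring₃ : ∀ c m σ → 48 * c * (3 * (2 * m) * (4 * σ)) + 192 * (c * σ) * m ≡ 1344 * (c * σ * m)
    ring₃ = solve-∀

  private
    instance
      h≢0 : NonZero h
      h≢0 = >-nonZero h>0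
      β≢0 : NonZero β
      β≢0 = >-nonZero β>0
      N≢0 : NonZero N
      N≢0 = >-nonZero (≤-trans β>0 β≤N)
      ℓ≢0 : NonZero ℓ
      ℓ≢0 = >-nonZero ℓ>0
      q≢0 : NonZero q
      q≢0 = >-nonZero q>0

    -- Density with n ≤ 6ℓqa inserted; 47200 is 1699200/36.
    copies-bound : 47200 * (h * m) ≤ q * (a * a)
    copies-bound = *-cancelˡ-≤ (36 * (ℓ * ℓ * q)) {{m*n≢0 36 (ℓ * ℓ * q) {{_}} {{m*n≢0 (ℓ * ℓ) q {{m*n≢0 ℓ ℓ}}}}}} (begin
      36 * (ℓ * ℓ * q) * (47200 * (h * m)) ≡⟨ ring₁ 36 47200 (ℓ * ℓ) q h m ⟩
      1699200 * h * (ℓ * ℓ) * q * m ≤⟨ *-monoˡ-≤ m (*-monoʳ-≤ (1699200 * h * (ℓ * ℓ)) q≤μ) ⟩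
      1699200 * h * (ℓ * ℓ) * μ * m ≤⟨ dense ⟩
      n * n ≤⟨ *-mono-≤ n≤ n≤ ⟩
      6 * (ℓ * (q * a)) * (6 * (ℓ * (q * a))) ≡⟨ ring₂ ℓ q a ⟩
      36 * (ℓ * ℓ * q) * (q * (a * a)) ∎)
      where
      ring₁ : ∀ c e l q h m → c * (l * q) * (e * (h * m)) ≡ c * e * h * l * q * m
      ring₁ = solve-∀
      ring₂ : ∀ ℓ q a → 6 * (ℓ * (q * a)) * (6 * (ℓ * (q * a))) ≡ 36 * (ℓ * ℓ * q) * (q * (a * a))
      ring₂ = solve-∀

    demand-bound : ∀ k → k * N ≤ k₀ * N + (k₀ * N + d * m + m) → (2 * k + d) * β ≤ 30 * m
    demand-bound k kN≤ = *-cancelʳ-≤ _ _ N (begin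
      (2 * k + d) * β * N ≡⟨ ring₁ k d β N ⟩
      2 * (k * N) * β + d * β * N ≤⟨ +-mono-≤ (*-monoˡ-≤ β (*-monoʳ-≤ 2 kN≤)) (*-monoˡ-≤ N dβ≤N) ⟩
      2 * (k₀ * N + (k₀ * N + d * m + m)) * β + N * N ≡⟨ ring₂ k₀ N d m β ⟩
      4 * (k₀ * β) * N + 2 * (d * β) * m + 2 * m * β + N * N
        ≤⟨ +-monoˡ-≤ (N * N) (+-mono-≤ (+-mono-≤ (*-monoˡ-≤ N (*-monoʳ-≤ 4 k₀β≤)) (*-monoˡ-≤ m (*-monoʳ-≤ 2 dβ≤N)))
             (*-monoʳ-≤ (2 * m) β≤N)) ⟩
      4 * (3 * N) * N + 2 * N * m + 2 * m * N + N * N ≡⟨ ring₃ N m ⟩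
      (13 * N + 4 * m) * N ≤⟨ *-monoˡ-≤ N (+-monoˡ-≤ (4 * m) (*-monoʳ-≤ 13 N≤2m)) ⟩
      (13 * (2 * m) + 4 * m) * N ≡⟨ ring₄ m N ⟩
      30 * m * N ∎)
      where
      ring₁ : ∀ k d β N → (2 * k + d) * β * N ≡ 2 * (k * N) * β + d * β * N
      ring₁ = solve-∀
      ring₂ : ∀ k N d m β → 2 * (k * N + (k * N + d * m + m)) * β + N * N ≡ 4 * (k * β) * N + 2 * (d * β) * m + 2 * m * β + N * N
      ring₂ = solve-∀
      ring₃ : ∀ N m → 4 * (3 * N) * N + 2 * N * m + 2 * m * N + N * N ≡ (13 * N + 4 * m) * N
      ring₃ = solve-∀
      ring₄ : ∀ m N → (13 * (2 * m) + 4 * m) * N ≡ 30 * m * N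
      ring₄ = solve-∀

  -- After scaling by 4hβ, the demand for elements is at most 120hm, while density and the
  -- popularity of the sums supply at least 47200hm.
  capacity-bound : ∀ k → k * N ≤ k₀ * N + (k₀ * N + d * m + m) → 2 * k + d ≤ t * q
  capacity-bound k kN≤ = *-cancelʳ-≤ _ _ (4 * h * β) {{m*n≢0 (4 * h) β {{m*n≢0 4 h}}}} (begin
    (2 * k + d) * (4 * h * β) ≡⟨ ring₁ (2 * k + d) h β ⟩
    4 * h * ((2 * k + d) * β) ≤⟨ *-monoʳ-≤ (4 * h) (demand-bound k kN≤) ⟩
    4 * h * (30 * m) ≡⟨ ring₂ h m ⟩
    120 * (h * m) ≤⟨ *-monoˡ-≤ (h * m) (≤ᵇ⇒≤ 120 47200 tt) ⟩
    47200 * (h * m) ≤⟨ copies-bound ⟩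
    q * (a * a) ≤⟨ *-monoʳ-≤ q a²≤ ⟩
    q * (4 * h * (t * β)) ≡⟨ ring₃ q h t β ⟩
    t * q * (4 * h * β) ∎)
    where
    ring₁ : ∀ c h β → c * (4 * h * β) ≡ 4 * h * (c * β)
    ring₁ = solve-∀
    ring₂ : ∀ h m → 4 * h * (30 * m) ≡ 120 * (h * m)
    ring₂ = solve-∀
    ring₃ : ∀ q h t β → q * (4 * h * (t * β)) ≡ t * q * (4 * h * β)
    ring₃ = solve-∀

-- Logarithmic hypotheses and the choice of parameters.

2^-cancel-≤ : ∀ i j → 2 ^ i ≤ 2 ^ j → i ≤ j
2^-cancel-≤ i j le with i ≤? j
... | yes p = p
... | no ¬p = ⊥-elim (<⇒≱ (^-monoʳ-< 2 ≤-refl (≰⇒> ¬p)) le)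

-- The integer `ℓ` is below log₂(2μ), hence below each of its rational upper bounds p/q.
few⇒almostDivisor : ∀ X ℓ e → 2 ^ ℓ ≤ 2 * μ X → 1 < e →
  length (notDivBy e X) * (size X * size X) ≤ 42480 * ℓ * μ X * Σ' X → AlmostDivisor X e
few⇒almostDivisor X ℓ e 2^ℓ≤ 1<e few = 1<e , λ p q below →
  let open ≤-Reasoning
      ℓq≤p : ℓ * q ≤ p
      ℓq≤p = 2^-cancel-≤ (ℓ * q) p (begin
        2 ^ (ℓ * q) ≡⟨ ^-*-assoc 2 ℓ q ⟨
        (2 ^ ℓ) ^ q ≤⟨ ^-monoˡ-≤ q 2^ℓ≤ ⟩
        (2 * μ X) ^ q ≤⟨ below ⟩
        2 ^ p ∎)
  in begin
    length (notDivBy e X) * (size X * size X) * q ≤⟨ *-monoˡ-≤ q few ⟩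
    42480 * ℓ * μ X * Σ' X * q ≡⟨ ring 42480 ℓ (μ X) (Σ' X) q ⟩
    42480 * (ℓ * q) * μ X * Σ' X ≤⟨ *-monoˡ-≤ (Σ' X) (*-monoˡ-≤ (μ X) (*-monoʳ-≤ 42480 ℓq≤p)) ⟩
    42480 * p * μ X * Σ' X ∎
  where
  ring : ∀ c l u s q → c * l * u * s * q ≡ c * (l * q) * u * s
  ring = solve-∀

module _ (X : List ℕ) (X≢[] : X ≢ []) (pos : All (0 <_) X) (dense : Dense X)
  (noDivisor : ∀ d → ¬ AlmostDivisor X d) where

  open ≤-Reasoning

  private
    n m σ : ℕ
    n = size X
    m = maxElem X
    σ = Σ' X

    witness : ∃[ x ] x ∈ X
    witness = go X X≢[]
      where
      go : ∀ xs → xs ≢ [] → ∃[ x ] x ∈ xs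
      go [] ne = ⊥-elim (ne refl)
      go (x ∷ _) _ = x , here refl

    n>0 : 0 < n
    n>0 = ∈-length (proj₂ witness)

    m>0 : 0 < m
    m>0 = ≤-trans (All.lookup pos (proj₂ witness)) (≤maxElem (proj₂ witness))

    σ>0 : 0 < σ
    σ>0 = go pos n>0
      where
      go : ∀ {xs} → All (0 <_) xs → 0 < length xs → 0 < sum xs
      go {x ∷ xs} (p ∷ _) _ = ≤-trans p (m≤m+n x (sum xs))

    μ>0 : 0 < μ X
    μ>0 = go X X≢[]
      where
      go : ∀ xs → xs ≢ [] → 0 < μ xs
      go [] ne = ⊥-elim (ne refl)
      go (x ∷ xs) _ = ≤-trans (≤-trans z<s (≤-reflexive (sym (mult-here x xs)))) (mult≤μ x (x ∷ xs))

    log-μ : ∃[ ℓ ] 0 < ℓ × 2 ^ ℓ ≤ 2 * μ X × μ X < 2 ^ ℓ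
    log-μ = log₂ (μ X) μ>0

    ℓ : ℕ
    ℓ = proj₁ log-μ
    ℓ>0 : 0 < ℓ
    ℓ>0 = proj₁ (proj₂ log-μ)
    2^ℓ≤ : 2 ^ ℓ ≤ 2 * μ X
    2^ℓ≤ = proj₁ (proj₂ (proj₂ log-μ))
    μ<2^ℓ : μ X < 2 ^ ℓ
    μ<2^ℓ = proj₂ (proj₂ (proj₂ log-μ))

    ^1 : ∀ {x y} → x ≤ y → x ≤ y ^ 1
    ^1 {y = y} le = ≤-trans le (≤-reflexive (sym (*-identityʳ y)))

    dense-at : ∀ h → 2 ^ h ≤ 2 * n → 1699200 * h * (ℓ * ℓ) * μ X * m ≤ n * n
    dense-at h 2^h≤ = ≤-trans (dense h 1 ℓ 1 (^1 2^h≤) (^1 2^ℓ≤))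
      (≤-reflexive (trans (*-identityʳ _) (*-identityʳ (n * n))))

    -- Density with `h` equal to 1 forces n² ≥ 1699200. What matters is that the light half of the
    -- small elements is then nonempty.
    n≥3 : 3 ≤ n
    n≥3 = ≰⇒> λ n≤2 → <⇒≱ (≤ᵇ⇒≤ 5 1699200 tt) (begin
      1699200 ≤⟨ m≤m*n 1699200 (ℓ * ℓ * μ X * m) {{>-nonZero (*-mono-≤ (*-mono-≤ (*-mono-≤ ℓ>0 ℓ>0) μ>0) m>0)}} ⟩
      1699200 * (ℓ * ℓ * μ X * m) ≡⟨ ring 1699200 (ℓ * ℓ) (μ X) m ⟩
      1699200 * 1 * (ℓ * ℓ) * μ X * m ≤⟨ dense-at 1 (*-monoʳ-≤ 2 n>0) ⟩
      n * n ≤⟨ *-mono-≤ n≤2 n≤2 ⟩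
      4 ∎)
      where
      ring : ∀ c l u m → c * (l * u * m) ≡ c * 1 * l * u * m
      ring = solve-∀

    small? : Decidable (λ x → x * n ≤ 2 * σ)
    small? x = x * n ≤? 2 * σ

    record LightPart : Set where
      field
        A O : List ℕ
        X↭ : X ↭ A ++ O
        light : 2 * sum A ≤ σ
        small : ∀ {x} → x ∈ A → x * n ≤ 2 * σ
        n≤6A : n ≤ 6 * length A
        A>0 : 0 < length A

    light-part : LightPart
    light-part =
      let A , A′ , S↭ , len , light = lighter-half S in record
      { A = A ; O = A′ ++ L
      ; X↭ = ↭-trans (split-↭ small? X) (↭-trans (++⁺ʳ L S↭) (↭-reflexive (++-assoc A A′ L)))
      ; light = ≤-trans light (≤-trans (m≤m+n (sum S) (sum L))
                  (≤-reflexive (trans (sym (sum-++ S L)) (sym (sum-↭ (split-↭ small? X))))))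
      ; small = λ x∈ → proj₂ (∈-filter⁻ small? {xs = X} (∈-resp-↭ (↭-sym S↭) (∈-++⁺ˡ x∈)))
      ; n≤6A = bound (length A) (positive (length A) (4A+2 (length A) len)) (4A+2 (length A) len)
      ; A>0 = positive (length A) (4A+2 (length A) len) }
      where
      S L : List ℕ
      S = filter small? X
      L = filter (¬? ∘ small?) X
      ring : ∀ k → 2 * (2 * k + 1) ≡ 4 * k + 2
      ring = solve-∀
      -- Halving twice loses at most 2 to rounding; once |A| ≥ 1 this becomes n ≤ 6|A|, the source
      -- of the constant 6.
      4A+2 : ∀ k → length S ≤ 2 * k + 1 → n ≤ 4 * k + 2
      4A+2 k le = ≤-trans (small-elements X σ>0) (≤-trans (*-monoʳ-≤ 2 le) (≤-reflexive (ring k)))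
      positive : ∀ k → n ≤ 4 * k + 2 → 0 < k
      positive zero le = ⊥-elim (<⇒≱ n≥3 le)
      positive (suc k) _ = z<s
      ring′ : ∀ k → 4 * k + 2 * k ≡ 6 * k
      ring′ = solve-∀
      bound : ∀ k → 0 < k → n ≤ 4 * k + 2 → n ≤ 6 * k
      bound k k>0 le = ≤-trans le (≤-trans (+-monoʳ-≤ (4 * k) (*-monoʳ-≤ 2 k>0)) (≤-reflexive (ring′ k)))

    module LowerHalf (y : ℕ) (λ≤y : LambdaLe X y) (2y≤ : 2 * y ≤ σ) (lp : LightPart) where
      open LightPart lp

      A⊆X : ∀ {x} → x ∈ A → x ∈ X
      A⊆X x∈ = ∈-resp-↭ (↭-sym X↭) (∈-++⁺ˡ x∈)

      mult-A≤μ : ∀ v → mult v A ≤ μ X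
      mult-A≤μ v = ≤-trans (≤-trans (m≤m+n _ (mult v O)) (≤-reflexive (sym (trans (mult-↭ v X↭) (mult-++ v A O))))) (mult≤μ v X)

      spread : ∀ d → d * (n * n) ≤ 42480 * ℓ * μ X * σ → ∀ e → 1 < e → d ≤ length (notDivBy e X)
      spread d bound e 1<e = ≮⇒≥ λ few → noDivisor e (few⇒almostDivisor X ℓ e 2^ℓ≤ 1<e
        (≤-trans (*-monoˡ-≤ (n * n) (<⇒≤ few)) bound))

      above : ∀ u → u * (n * n) ≤ 169920 * ℓ * μ X * m * σ → u ≤ y
      above u bound = *-cancelʳ-≤ u y (n * n) {{m*n≢0 n n {{>-nonZero n>0}} {{>-nonZero n>0}}}}
        (≤-trans bound (≤-trans (λ≤y ℓ 1 (^1 2^ℓ≤)) (≤-reflexive (*-identityʳ _))))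

      module _ (q v₀ : ℕ) (V₀ : List ℕ) (uV : Unique (v₀ ∷ V₀))
        (V-spec : ∀ {v} → v ∈ v₀ ∷ V₀ → v ∈ A × q ≤ mult v A)
        (A≤ : length A ≤ ℓ * (q * length (v₀ ∷ V₀))) where

        V : List ℕ
        V = v₀ ∷ V₀

        V⊆X : ∀ {v} → v ∈ V → v ∈ X
        V⊆X v∈ = A⊆X (proj₁ (V-spec v∈))

        V-pos : ∀ {v} → v ∈ V → 0 < v
        V-pos v∈ = All.lookup pos (V⊆X v∈)

        q>0 : 0 < q
        q>0 = n≢0⇒n>0 λ { refl → <⇒≱ A>0 (≤-trans A≤ (≤-reflexive (*-zeroʳ ℓ))) }

        from-sums : ∀ h → 0 < h → 2 ^ h ≤ 2 * length V → ∀ t B →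
          (∀ {b} → b ∈ B → 0 < b × b ≤ 2 * maxElem V × t ≤ reps b (0 ∷ V)) →
          length V * length V ≤ 4 * h * (t * length B) → length V ≤ 8 * length B → 0 < length B →
          Progression B → InSubsetSums y X
        from-sums h h>0 2^h≤ t B B-spec a²≤ a≤ β>0 prog =
          Assembly.assemble X A O m X↭ (All.tabulate ≤maxElem) m>0 light q t (0 ∷ V) B
            (All.tabulate (λ v∈ → <⇒≢ (V-pos v∈)) ∷ uV) (λ { (here refl) () ; (there v∈) _ → proj₂ (V-spec v∈) })
            (λ b∈ → proj₂ (proj₂ (B-spec b∈))) N d k₀ d>0 represent
            (spread d divisor-bound) capacity-bound y (above (k₀ * N + d * m) start-bound) 2y≤
          where
          open Progression prog
          open Bounds n σ m (μ X) ℓ q (length V) h t (length B) N (maxElem V) d k₀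
            -- Density is stated with log(2n), and `h` qualifies because `V` consists of distinct
            -- elements of `X`.
            (dense-at h (≤-trans 2^h≤ (*-monoʳ-≤ 2 (unique-⊆-length uV V⊆X))))
            (≤-trans n≤6A (*-monoʳ-≤ 6 A≤))
            (≤-trans (proj₂ (V-spec (here refl))) (mult-A≤μ v₀))
            a≤ a²≤ (proj₁ (proj₂ (B-spec N∈B)))
            (≤maxElem (V⊆X (maxElem-∈ v₀ V₀))) (small (proj₁ (V-spec (maxElem-∈ v₀ V₀))))
            d*β≤N β≤N k₀*β≤3N ℓ>0 q>0 h>0 β>0

        from-log : ∃[ h ] 0 < h × 2 ^ h ≤ 2 * length V × length V < 2 ^ h → InSubsetSums y X
        from-log (h , h>0 , 2^h≤ , a<2^h) =
          cases (popular-sums V (maxElem V) h uV (λ v∈ → V-pos v∈ , ≤maxElem v∈) h>0 2^h≤ a<2^h)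
          where
          cases : _ → InSubsetSums y X
          cases (t , b ∷ B , uB , B-spec , a²≤ , a≤) =
            from-sums h h>0 2^h≤ t (b ∷ B) B-spec a²≤ a≤ z<s
              (progression b B uB (All.tabulate (λ b∈ → proj₁ (B-spec b∈))))

      lower-half : InSubsetSums y X
      lower-half = cases (popular-values A ℓ ℓ>0 (λ v → ≤-<-trans (mult-A≤μ v) μ<2^ℓ))
        where
        cases : _ → InSubsetSums y X
        cases (q , [] , _ , _ , A≤) = ⊥-elim (<⇒≱ A>0 (≤-trans A≤
          (≤-reflexive (trans (cong (ℓ *_) (*-zeroʳ q)) (*-zeroʳ ℓ)))))
        cases (q , v₀ ∷ V₀ , uV , V-spec , A≤) =
          from-log q v₀ V₀ uV V-spec A≤ (log₂ (suc (length V₀)) z<s)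

    lower-half : ∀ y → LambdaLe X y → 2 * y ≤ σ → InSubsetSums y X
    lower-half y λ≤y 2y≤ = LowerHalf.lower-half y λ≤y 2y≤ light-part

  -- One of `k` and `σ ∸ k` is at most half of the total, and the two hypotheses on λ are exchanged
  -- by complementation.
  subset-sum : ∀ k → LambdaLe X k → k ≤ σ → LambdaLe X (σ ∸ k) → InSubsetSums k X
  subset-sum k λ≤k k≤σ λ≤σ-k = by-half (≤-total (2 * k) σ)
    where
    by-half : 2 * k ≤ σ ⊎ σ ≤ 2 * k → InSubsetSums k X
    by-half (inj₁ 2k≤σ) = lower-half k λ≤k 2k≤σ
    by-half (inj₂ σ≤2k) =
      let Y , Y⊆X , eq = lower-half (σ ∸ k) λ≤σ-k (begin
            2 * (σ ∸ k) ≡⟨ *-distribˡ-∸ 2 σ k ⟩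
            2 * σ ∸ 2 * k ≤⟨ ∸-monoʳ-≤ (2 * σ) σ≤2k ⟩
            2 * σ ∸ σ ≡⟨ m+n∸m≡n σ (σ + 0) ⟩
            σ + 0 ≡⟨ +-identityʳ σ ⟩
            σ ∎)
          Z , Z⊆X , Y+Z = complement Y⊆X
      in Z , Z⊆X , +-cancelˡ-≡ (σ ∸ k) _ _ (trans (cong (_+ sum Z) (sym eq)) (trans Y+Z (sym (m∸n+n≡m k≤σ))))

theorem4p2 : (X : List ℕ) → X ≢ [] → All (0 <_) X →
    Dense X → (∀ d → ¬ AlmostDivisor X d) →
    ∀ k → LambdaLe X k → k ≤ Σ' X → LambdaLe X (Σ' X ∸ k) →
    InSubsetSums k X
theorem4p2 = subset-sum
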